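{- For every $\varepsilon,\eta>0$, there exist constants $\delta=\delta(\varepsilon,\eta)>0$ and $C=C(\varepsilon)>0$ (with $C$ depending only on $\varepsilon$, not on $\eta$) with the following property: for all $n,r\in\mathbb{N}$ with $\varepsilon n\le r\le(1/2-\varepsilon)n$, we have \[ e(\mathcal{A})\ge \ell(\mathcal{A})^{1+\delta}-C\,\ell(\mathcal{A}) \] for any family $\mathcal{A}$ of $r$-element subsets of $[n]=\{1,\dots,n\}$ with $|\mathcal{A}|=\binom{n-1}{r-1}$ and $\ell(\mathcal{A})\le\binom{n-1}{r-1}^{1-\eta}$.
   Context: For a family $\mathcal{A}$ of $r$-element subsets of $[n]$, $e(\mathcal{A})$ denotes the number of (unordered) pairs of disjoint sets in $\mathcal{A}$. A family is intersecting if any two of its members have nonempty intersection. $\ell(\mathcal{A})=|\mathcal{A}|-|\mathcal{A}^*|$, where $\mathcal{A}^*$ is an intersecting subfamily of $\mathcal{A}$ of maximum cardinality. -}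

module Defs where

open import Algebra.Definitions.RawSemiring using () renaming (_^_ to pow)
open import Data.Fin.Subset using (Subset; Nonempty; Empty; _∩_)
open import Data.Fin.Subset.Properties using (nonempty?)
open import Data.Integer using (ℤ; +_; -[1+_])
open import Data.List using (List; []; _∷_; _++_; map; filter; length)
open import Data.List.Extrema.Nat using (argmax)
open import Data.List.Relation.Unary.All using (All; all?)
open import Data.Nat using (ℕ; zero; suc; _∸_)
import Data.Nat as ℕ
open import Data.Product using (_×_; ∃-syntax)
open import Data.Rational using (ℚ; 0ℚ; _+_; -_; _<_; _/_; ↥_; ↧ₙ_; +-*-rawSemiring)
open import Data.Sum using (_⊎_)
open import Function.Bundles using (_⇔_)
open import Relation.Binary.PropositionalEquality using (_≡_)
open import Relation.Nullary using (¬_; Dec; ¬?)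

-- Real numbers are Dedekind cuts of rationals: lower x q reads "q < x" and
-- upper x q reads "x < q".  The operations below are defined on arbitrary
-- pairs of predicates; they have their usual meaning on cuts satisfying IsReal.

record Cut : Set₁ where
  field
    lower : ℚ → Set
    upper : ℚ → Set

open Cut public

record IsReal (x : Cut) : Set where
  field
    lower-inhabited : ∃[ q ] lower x q
    upper-inhabited : ∃[ q ] upper x q
    lower-rounded   : ∀ q → lower x q ⇔ (∃[ p ] q < p × lower x p)
    upper-rounded   : ∀ q → upper x q ⇔ (∃[ p ] p < q × upper x p)
    disjoint        : ∀ q → ¬ (lower x q × upper x q)
    located         : ∀ p q → p < q → lower x p ⊎ upper x q

infix  4 _<ᴿ_ _≤ᴿ_
infixl 6 _+ᴿ_ _-ᴿ_
infixl 7 _·ᴿ_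
infixr 8 _^ᴿ_
infix  8 -ᴿ_

_<ᴿ_ : Cut → Cut → Set
x <ᴿ y = ∃[ q ] upper x q × lower y q

_≤ᴿ_ : Cut → Cut → Set
x ≤ᴿ y = ¬ (y <ᴿ x)

fromℚ : ℚ → Cut
fromℚ p = record { lower = λ q → q < p ; upper = λ q → p < q }

fromℕ : ℕ → Cut
fromℕ n = fromℚ (+ n / 1)

_+ᴿ_ : Cut → Cut → Cut
x +ᴿ y = record
  { lower = λ q → ∃[ a ] ∃[ b ] lower x a × lower y b × q ≡ a + b
  ; upper = λ q → ∃[ a ] ∃[ b ] upper x a × upper y b × q ≡ a + b
  }

-ᴿ_ : Cut → Cut
-ᴿ x = record { lower = λ q → upper x (- q) ; upper = λ q → lower x (- q) }

_-ᴿ_ : Cut → Cut → Cut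
x -ᴿ y = x +ᴿ (-ᴿ y)

_·ᴿ_ : ℕ → Cut → Cut
zero  ·ᴿ x = fromℕ 0
suc n ·ᴿ x = x +ᴿ (n ·ᴿ x)

infixr 8 _^ℚ_

_^ℚ_ : ℚ → ℕ → ℚ
_^ℚ_ = pow +-*-rawSemiring

-- (suc k) ^ z for an integer exponent z.
zpow : ℕ → ℤ → ℚ
zpow k (+ m)    = (+ suc k / 1) ^ℚ m
zpow k -[1+ m ] = (+ 1 / suc k) ^ℚ suc m

-- (suc k) ^ s for a rational exponent s = z / d: the positive d-th root
-- of (suc k) ^ z.
qpow : ℕ → ℚ → Cut
qpow k s = record
  { lower = λ q → q < 0ℚ ⊎ q ^ℚ (↧ₙ s) < zpow k (↥ s)
  ; upper = λ q → 0ℚ < q × zpow k (↥ s) < q ^ℚ (↧ₙ s)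
  }

-- Real powers of a natural number.  For base a ≥ 1 the map s ↦ a ^ s is
-- monotone and continuous, so a ^ y is determined by the rational powers
-- below and above y.  Base 0 is given the value that is correct for positive
-- exponents only.
_^ᴿ_ : ℕ → Cut → Cut
zero  ^ᴿ y = fromℕ 0
suc k ^ᴿ y = record
  { lower = λ q → ∃[ s ] lower y s × lower (qpow k s) q
  ; upper = λ q → ∃[ s ] upper y s × upper (qpow k s) q
  }

-- A family of subsets of [n] is a list of subsets; that it has no repetitions
-- is a separate hypothesis (Unique), under which length is cardinality.
Family : ℕ → Set
Family n = List (Subset n)

Intersecting : ∀ {n} → Family n → Set
Intersecting 𝒜 = All (λ A → All (λ B → Nonempty (A ∩ B)) 𝒜) 𝒜

intersecting? : ∀ {n} (𝒜 : Family n) → Dec (Intersecting 𝒜)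
intersecting? 𝒜 = all? (λ A → all? (λ B → nonempty? (A ∩ B)) 𝒜) 𝒜

Disjoint : ∀ {n} → Subset n → Subset n → Set
Disjoint A B = Empty (A ∩ B)

disjoint? : ∀ {n} (A B : Subset n) → Dec (Disjoint A B)
disjoint? A B = ¬? (nonempty? (A ∩ B))

-- Each unordered pair is counted once, at whichever member comes first.
e : ∀ {n} → Family n → ℕ
e []      = 0
e (A ∷ 𝒜) = length (filter (disjoint? A) 𝒜) ℕ.+ e 𝒜

subfamilies : ∀ {n} → Family n → List (Family n)
subfamilies []      = [] ∷ []
subfamilies (A ∷ 𝒜) = map (A ∷_) (subfamilies 𝒜) ++ subfamilies 𝒜

-- An intersecting subfamily of maximum cardinality; the default value [] is
-- itself an intersecting subfamily.
_* : ∀ {n} → Family n → Family n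
𝒜 * = argmax length [] (filter intersecting? (subfamilies 𝒜))

ℓ : ∀ {n} → Family n → ℕ
ℓ 𝒜 = length 𝒜 ∸ length (𝒜 *)

-- Let N = C(n-1,r-1) and Q = C(n-2,r-1).  The (r-1)-sets of [n] ∖ {x} that are disjoint from one of b given r-sets
-- missing x form a shadow of the family of complements.  By a piecewise linear form of the Kruskal–Katona theorem
-- (chords between consecutive integer points of the Lovász curve) their number exceeds b by a constant factor for small b
-- and is still at least b up to b = Q.  Applied to the members of 𝒜* missing x, none of whose neighbours lies in 𝒜*, this shows that
-- their number b is either O(ℓ) or at least Q − O(ℓ).  The codegrees add up to (n-r) ∣𝒜*∣, about (n-1) Q, so the second
-- alternative cannot hold at all n points; hence some star contains all but t = O(ℓ) members of 𝒜, and t ≥ ℓ.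
-- As t ≤ N^(1-η′), the shadow of the t exceptional sets is exponentially larger than t, and all but t of the r-sets it
-- yields are members of 𝒜: this gives e(𝒜) ≥ t (1 + 1/E)^j − t with j linear in n, whereas ℓ^δ ≤ 2^(δ n).
-- For bounded n, ℓ^δ ≤ 2 when δ is small, so that C = 2 suffices.

module Submission where

open import Defs renaming (_* to _⋆)
open import Data.Nat using (ℕ; NonZero; _∸_)
open import Data.Nat.Combinatorics using () renaming (_C_ to _choose_)
open import Data.Fin.Subset using (∣_∣)
open import Data.List using (length)
open import Data.List.Relation.Unary.All using (All)
open import Data.List.Relation.Unary.Unique.Propositional using (Unique)
open import Data.Product using (Σ-syntax; _×_)
open import Relation.Binary.PropositionalEquality using (_≡_)

-- Binomials with a real upper index are avoided: only the integer points of the Lovász curve and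
-- the segments between them occur. A position θ = u / v on a segment is kept as a pair of naturals,
-- so all inequalities are cross-multiplied into ℕ and left to the ring solver. These segment bounds
-- reproduce themselves under induction on the ground set, and without compressions, because the
-- half of the shadow that avoids the removed point is fed by both halves of the family. Both
-- alternatives of the stability step come from one integer point, z = n - 3. With k = n - 1 - r and
-- s = r - 1 the layers k and s there have sizes in the ratio s : k, so the distance of r from n / 2
-- enters as k - s. The real ε is replaced by 1 / E < ε, which gives n ≤ E r and k - s ≥ 2 n / E,
-- and η by 1 / H < η. The conclusion is first reached in ℕ as ℓ^(q+1) ≤ (e + 2ℓ)^q, with δ = 1 / q.

module Combinatorics where

  open import Data.Bool using (Bool; true; false; _∧_; _∨_; not; if_then_else_)
  open import Data.Bool.Properties using () renaming (_≟_ to _≟ᵇ_)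
  open import Data.Fin using (Fin; zero; suc)
  open import Data.Fin.Properties using (any?)
  open import Data.Fin.Subset using (Subset; inside; outside; ∁; ⊥)
  open import Data.Fin.Subset.Properties using (∣⊥∣≡0; ∉⊥; x∈p∩q⁻; x∈p∩q⁺; x∈p⇒x∉∁p; ∣∁p∣≡n∸∣p∣; ∩-comm)
  open import Data.List using ([]; _∷_; map; filter)
  open import Data.List.Extrema.Nat using (argmax-all; f[xs]≤f[argmax])
  open import Data.List.Membership.Propositional using (_∈_)
  open import Data.List.Membership.Propositional.Properties using (∈-++⁺ˡ; ∈-++⁺ʳ; ∈-map⁺; ∈-filter⁺)
  open import Data.List.Relation.Binary.Sublist.Propositional using (_⊆_; []; _∷ʳ_; _∷_; minimum)
  open import Data.List.Relation.Binary.Sublist.Propositional.Properties using (All-resp-⊆; length-mono-≤)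
  open import Data.List.Relation.Unary.All as All using ([]; _∷_)
  import Data.List.Relation.Unary.All.Properties as All
  open import Data.List.Relation.Unary.AllPairs using ([]; _∷_)
  open import Data.List.Relation.Unary.Any using (here; there)
  open import Data.Nat
  open import Data.Nat.Combinatorics using (nCk+nC[k+1]≡[n+1]C[k+1]; nCk≡nC[n∸k]; nCn≡1; k>n⇒nCk≡0)
  open import Data.Nat.DivMod using (_/_; m/n*n≤m; m%n<n; m≡m%n+[m/n]*n)
  open import Data.Nat.ListAction using (sum)
  open import Data.Nat.Properties
  open import Algebra.Properties.CommutativeMonoid.Sum +-0-commutativeMonoid using (∑-distrib-+; sum-replicate-zero) renaming (sum to ∑ᶠ)
  open import Algebra.Properties.CommutativeSemigroup +-commutativeSemigroup using (interchange)
  open import Data.Nat.Tactic.RingSolver using (solve-∀)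
  open import Data.Product using (∃-syntax; _,_; proj₁; proj₂)
  open import Data.Sum using (_⊎_; inj₁; inj₂)
  open import Data.Vec using ([]; _∷_; here; there; insertAt; lookup)
  open import Data.Vec.Properties using (insertAt-lookup; lookup⇒[]=) renaming (≡-dec to Vec-≡-dec)
  open import Function using (_∘_)
  open import Relation.Binary.PropositionalEquality
    using (refl; sym; trans; cong; cong₂; subst; subst₂; module ≡-Reasoning)
  open import Relation.Nullary using (¬_; Dec; yes; no; does; contradiction)
  open import Relation.Nullary.Decidable using (dec-true; dec-false)

  -- Binomial coefficients

  -- Y − X is q − p plus a nonnegative slack.
  ≤-by : ∀ {p q} X Y slack → p ≤ q → X + q + slack ≡ Y + p → X ≤ Y
  ≤-by {p} {q} X Y slack p≤q eq = +-cancelʳ-≤ q X Y (begin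
    X + q          ≤⟨ m≤m+n (X + q) slack ⟩
    X + q + slack  ≡⟨ eq ⟩
    Y + p          ≤⟨ +-monoʳ-≤ Y p≤q ⟩
    Y + q          ∎)
    where open ≤-Reasoning

  C : ℕ → ℕ → ℕ
  C n       zero    = 1
  C zero    (suc k) = 0
  C (suc n) (suc k) = C n (suc k) + C n k

  -- C⁻ n k is the binomial coefficient with lower index k − 1.
  C⁻ : ℕ → ℕ → ℕ
  C⁻ n zero    = 0
  C⁻ n (suc k) = C n k

  C≡choose : ∀ n k → C n k ≡ n choose k
  C≡choose n       zero    = sym (trans (nCk≡nC[n∸k] {0} {n} z≤n) (nCn≡1 n))
  C≡choose zero    (suc k) = sym (k>n⇒nCk≡0 {0} {suc k} z<s)
  C≡choose (suc n) (suc k) = begin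
    C n (suc k) + C n k            ≡⟨ +-comm (C n (suc k)) _ ⟩
    C n k + C n (suc k)            ≡⟨ cong₂ _+_ (C≡choose n k) (C≡choose n (suc k)) ⟩
    n choose k + n choose (suc k)  ≡⟨ nCk+nC[k+1]≡[n+1]C[k+1] n k ⟩
    suc n choose suc k             ∎
    where open ≡-Reasoning

  C-pascal : ∀ n k → C (suc n) k ≡ C n k + C⁻ n k
  C-pascal n zero    = refl
  C-pascal n (suc k) = refl

  C-absorb : ∀ n k → suc k * C (suc n) (suc k) ≡ suc n * C n k
  C-absorb zero    zero    = refl
  C-absorb zero    (suc k) = *-zeroʳ k
  C-absorb (suc n) zero    = begin
    1 * (C (suc n) 1 + 1)    ≡⟨ *-distribˡ-+ 1 (C (suc n) 1) 1 ⟩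
    1 * C (suc n) 1 + 1 * 1  ≡⟨ cong (_+ 1) (C-absorb n 0) ⟩
    suc n * 1 + 1            ≡⟨ id₁ n ⟩
    suc (suc n) * 1          ∎
    where
    open ≡-Reasoning
    id₁ : ∀ n → suc n * 1 + 1 ≡ suc (suc n) * 1
    id₁ = solve-∀
  C-absorb (suc n) (suc k) = begin
    suc (suc k) * (x + y)                          ≡⟨ id₁ k x y ⟩
    suc (suc k) * x + (suc k * y + y)              ≡⟨ cong₂ (λ a b → a + (b + y)) (C-absorb n (suc k)) (C-absorb n k) ⟩
    suc n * C n (suc k) + (suc n * C n k + y)      ≡⟨ id₂ n (C n (suc k)) (C n k) ⟩
    suc (suc n) * (C n (suc k) + C n k)            ∎
    where
    open ≡-Reasoning
    x = C (suc n) (suc (suc k))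
    y = C (suc n) (suc k)
    id₁ : ∀ k x y → suc (suc k) * (x + y) ≡ suc (suc k) * x + (suc k * y + y)
    id₁ = solve-∀
    id₂ : ∀ n a b → suc n * a + (suc n * b + (a + b)) ≡ suc (suc n) * (a + b)
    id₂ = solve-∀

  C-sucʳ : ∀ n k → suc k * C n (suc k) + k * C n k ≡ n * C n k
  C-sucʳ n k = +-cancelʳ-≡ (C n k) _ _ (begin
    suc k * C n (suc k) + k * C n k + C n k  ≡⟨ id₁ k (C n (suc k)) (C n k) ⟩
    suc k * (C n (suc k) + C n k)            ≡⟨ C-absorb n k ⟩
    suc n * C n k                            ≡⟨ +-comm (C n k) _ ⟩
    n * C n k + C n k                        ∎)
    where
    open ≡-Reasoning
    id₁ : ∀ k x y → suc k * x + k * y + y ≡ suc k * (x + y)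
    id₁ = solve-∀

  C-sucˡ : ∀ n k → suc n * C n k + k * C (suc n) k ≡ suc n * C (suc n) k
  C-sucˡ n zero    = +-identityʳ _
  C-sucˡ n (suc k) = begin
    suc n * C n (suc k) + suc k * C (suc n) (suc k)  ≡⟨ cong (suc n * C n (suc k) +_) (C-absorb n k) ⟩
    suc n * C n (suc k) + suc n * C n k              ≡⟨ *-distribˡ-+ (suc n) (C n (suc k)) (C n k) ⟨
    suc n * C (suc n) (suc k)                        ∎
    where open ≡-Reasoning

  -- The ratios (n - i) / (i + 1) of consecutive binomials decrease in i. After multiplication by (i
  -- + 1)(j + 1) the two sides differ by exactly `x * y * suc n * d`, where d = j - i; the summands
  -- added on both sides of `eq` replace the subtractions in n - i and n - j.
  C-log-concave : ∀ n {i j} → i ≤ j → C n i * C n (suc j) ≤ C n (suc i) * C n j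
  C-log-concave n {i} {j} i≤j with m≤n⇒∃[o]m+o≡n i≤j
  ... | d , refl = *-cancelˡ-≤ (suc i * suc (i + d)) (begin
    suc i * suc (i + d) * (x * w)                        ≤⟨ m≤m+n _ (x * y * suc n * d) ⟩
    suc i * suc (i + d) * (x * w) + x * y * suc n * d    ≡⟨ +-cancelʳ-≡ (suc (i + d) * y * (i * x) + suc i * x * ((i + d) * y)) _ _ eq ⟩
    suc i * suc (i + d) * (z * y)                        ∎)
    where
    open ≤-Reasoning
    x = C n i
    z = C n (suc i)
    y = C n (i + d)
    w = C n (suc (i + d))
    id₁ : ∀ i d n x y z w →
          suc i * suc (i + d) * (x * w) + x * y * suc n * d + (suc (i + d) * y * (i * x) + suc i * x * ((i + d) * y))
          ≡ suc i * x * (suc (i + d) * w + (i + d) * y) + suc (i + d) * y * (i * x) + x * y * suc n * d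
    id₁ = solve-∀
    id₂ : ∀ i d n x y z → 
          suc i * x * (n * y) + suc (i + d) * y * (i * x) + x * y * suc n * d
          ≡ suc (i + d) * y * (n * x) + suc i * x * ((i + d) * y)
    id₂ = solve-∀
    id₃ : ∀ i d x y z →
          suc (i + d) * y * (suc i * z + i * x) + suc i * x * ((i + d) * y)
          ≡ suc i * suc (i + d) * (z * y) + (suc (i + d) * y * (i * x) + suc i * x * ((i + d) * y))
    id₃ = solve-∀
    eq : suc i * suc (i + d) * (x * w) + x * y * suc n * d + (suc (i + d) * y * (i * x) + suc i * x * ((i + d) * y))
       ≡ suc i * suc (i + d) * (z * y) + (suc (i + d) * y * (i * x) + suc i * x * ((i + d) * y))
    eq = trans (id₁ i d n x y z w)
        (trans (cong (λ e → suc i * x * e + suc (i + d) * y * (i * x) + x * y * suc n * d) (C-sucʳ n (i + d)))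
        (trans (id₂ i d n x y z)
        (trans (cong (λ e → suc (i + d) * y * e + suc i * x * ((i + d) * y)) (sym (C-sucʳ n i)))
               (id₃ i d x y z))))

  C⁻-log-concave : ∀ n {i j} → i ≤ j → C⁻ n i * C n j ≤ C n i * C⁻ n j
  C⁻-log-concave n {zero}  {j}     i≤j = z≤n
  C⁻-log-concave n {suc i} {suc j} i≤j = C-log-concave n (≤-pred i≤j)

  C>0 : ∀ {n k} → k ≤ n → 0 < C n k
  C>0 {n}     {zero}  _         = z<s
  C>0 {suc n} {suc k} (s≤s k≤n) = ≤-trans (C>0 k≤n) (m≤n+m (C n k) (C n (suc k)))

  C>n : ∀ {n k} → n < k → C n k ≡ 0
  C>n {n} {k} n<k = trans (C≡choose n k) (k>n⇒nCk≡0 n<k)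

  C-diag : ∀ n → C n n ≡ 1
  C-diag n = trans (C≡choose n n) (nCn≡1 n)

  C-sym : ∀ k s → C (k + s) k ≡ C (k + s) s
  C-sym k s = begin
    C (k + s) k                      ≡⟨ C≡choose (k + s) k ⟩
    (k + s) choose k                 ≡⟨ nCk≡nC[n∸k] (m≤m+n k s) ⟩
    (k + s) choose (k + s ∸ k)       ≡⟨ cong ((k + s) choose_) (m+n∸m≡n k s) ⟩
    (k + s) choose s                 ≡⟨ C≡choose (k + s) s ⟨
    C (k + s) s                      ∎
    where open ≡-Reasoning

  -- The piecewise linear Kruskal–Katona theorem

  -- With θ = u / v: a family of θ C(z,k) sets has a shadow of θ C(z,s) sets.
  Linear : (z k s f g : ℕ) → Set
  Linear z k s f g = ∀ u v → u ≤ v → u * C z k ≤ v * f → u * C z s ≤ v * g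

  -- The chord of the Kruskal–Katona curve between the points z and z + 1.
  Chord : (z k s f g : ℕ) → Set
  Chord z k s f g = ∀ u v → u ≤ v → v * C z k + u * C⁻ z k ≤ v * f → v * C z s + u * C⁻ z s ≤ v * g

  -- The rays from the origin to the points (`C z k`, `C z s`) get flatter as z grows, since by
  -- log-concavity (`bA≤aB`) the chord leaving such a point has slope b / B ≤ a / A. So each ray
  -- lies below the polygon of chords up to its end point, and θ ≤ 1 caps it from there on.
  chord⇒linear : ∀ {k s f g} → s ≤ k → (∀ z → k ≤ z → Chord z k s f g) → ∀ z → k ≤ z → Linear z k s f g
  chord⇒linear {k} {s} {f} {g} s≤k chord z k≤z = subst (λ z → Linear z k s f g) (m+[n∸m]≡n k≤z) (go (z ∸ k))
    where
    open ≤-Reasoning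
    full : ∀ z → k ≤ z → C z k ≤ f → Linear z k s f g
    full z k≤z Ck≤f u v u≤v _ = begin
      u * C z s  ≤⟨ *-monoˡ-≤ (C z s) u≤v ⟩
      v * C z s  ≤⟨ *-monoʳ-≤ v (subst₂ _≤_ (id₁ (C z s)) (*-identityˡ g) (chord z k≤z 0 1 z≤n (subst₂ _≤_ (sym (id₁ (C z k))) (sym (*-identityˡ f)) Ck≤f))) ⟩
      v * g      ∎
      where
      id₁ : ∀ x → 1 * x + 0 ≡ x
      id₁ x = trans (+-identityʳ _) (*-identityˡ x)
    go : ∀ i → Linear (k + i) k s f g
    go zero with 1 ≤? f
    ... | yes 1≤f rewrite +-identityʳ k = full k ≤-refl (subst (_≤ f) (sym (C-diag k)) 1≤f)
    ... | no ¬1≤f rewrite +-identityʳ k | C-diag k | n<1⇒n≡0 (≰⇒> ¬1≤f) = λ u v u≤v h →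
          subst (λ u → u * C k s ≤ v * g) (sym (n≤0⇒n≡0 (subst₂ _≤_ (*-identityʳ u) (*-zeroʳ v) h))) z≤n
    go (suc i) rewrite +-suc k i with C (suc (k + i)) k ≤? f
    ... | yes p = full (suc (k + i)) (m≤n⇒m≤1+n (m≤m+n k i)) p
    ... | no ¬p rewrite C-pascal (k + i) k | C-pascal (k + i) s = below
      where
      A = C (k + i) k
      B = C⁻ (k + i) k
      a = C (k + i) s
      b = C⁻ (k + i) s
      bA≤aB : b * A ≤ a * B
      bA≤aB = C⁻-log-concave (k + i) s≤k
      f<A+B : f < A + B
      f<A+B = ≰⇒> ¬p
      below : ∀ u v → u ≤ v → u * (A + B) ≤ v * f → u * (a + b) ≤ v * g
      below u v u≤v h with A ≤? f
      -- Below A the ray to the previous integer point is used at θ = f / A, the largest value that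
      -- f allows.
      ... | no A≰f = *-cancelˡ-≤ A {{>-nonZero (C>0 (m≤m+n k i))}} (≤-by _ _ 0
            (+-mono-≤ (*-monoʳ-≤ v (go i f A (<⇒≤ (≰⇒> A≰f)) (≤-reflexive (*-comm f A))))
              (+-mono-≤ (*-monoʳ-≤ a h) (*-monoʳ-≤ u bA≤aB)))
            (id₁ A B a b u v f g))
        where
        id₁ : ∀ A B a b u v f g →
          A * (u * (a + b)) + (v * (A * g) + (a * (v * f) + u * (a * B))) + 0 ≡ A * (v * g) + (v * (f * a) + (a * (u * (A + B)) + u * (b * A)))
        id₁ = solve-∀
      ... | yes A≤f with m≤n⇒∃[o]m+o≡n A≤f
      ... | w , refl = *-cancelˡ-≤ B {{>-nonZero (≤-<-trans z≤n w<B)}} main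
        where
        w<B : w < B
        w<B = +-cancelˡ-< A w B f<A+B
        Ig : B * a + w * b ≤ B * g
        Ig = chord (k + i) (m≤m+n k i) w B (<⇒≤ w<B) (≤-reflexive (id₀ A B w))
          where
          id₀ : ∀ A B w → B * A + w * B ≡ B * (A + w)
          id₀ = solve-∀
        main : B * (u * (a + b)) ≤ B * (v * g)
        main with m≤n⇒∃[o]m+o≡n u≤v | ≤-total (u * B) (v * w)
        ... | t , refl | inj₁ uB≤vw = ≤-by _ _ (t * B * a)
              (+-mono-≤ (*-monoʳ-≤ (u + t) Ig) (*-monoʳ-≤ b uB≤vw)) (id₂ A B a b u t w g)
          where
          id₂ : ∀ A B a b u t w g →
            B * (u * (a + b)) + ((u + t) * (B * g) + b * ((u + t) * w)) + t * B * a
            ≡ B * ((u + t) * g) + ((u + t) * (B * a + w * b) + b * (u * B))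
          id₂ = solve-∀
        -- Here θ = u / v exceeds the chord parameter w / B. The excess ξ = u B - v w is at most (v
        -- - u) A, and b / B ≤ a / A pays for it.
        ... | t , refl | inj₂ vw≤uB with m≤n⇒∃[o]m+o≡n vw≤uB
        ... | ξ , eq = ≤-by _ _ 0
              (+-mono-≤ (*-monoʳ-≤ (u + t) Ig) (+-mono-≤ (*-monoʳ-≤ b ξ≤tA) (*-monoʳ-≤ t bA≤aB)))
              (trans (id₃ B a b A u t w g) (trans (cong (λ e → e * b + (B * (u * a) + ((u + t) * (B * g) + (b * (t * A) + t * (a * B))))) (sym eq)) (id₄ B a b A u t w g ξ)))
          where
          ξ≤tA : ξ ≤ t * A
          ξ≤tA = ≤-by _ _ 0 h (trans (id₅ ξ A u t w) (trans (cong (λ e → e + (t * A + u * A)) eq) (id₆ A B u t)))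
            where
            id₅ : ∀ ξ A u t w → ξ + (u + t) * (A + w) + 0 ≡ (u + t) * w + ξ + (t * A + u * A)
            id₅ = solve-∀
            id₆ : ∀ A B u t → u * B + (t * A + u * A) ≡ t * A + u * (A + B)
            id₆ = solve-∀
          id₃ : ∀ B a b A u t w g →
            B * (u * (a + b)) + ((u + t) * (B * g) + (b * (t * A) + t * (a * B))) + 0
            ≡ u * B * b + (B * (u * a) + ((u + t) * (B * g) + (b * (t * A) + t * (a * B))))
          id₃ = solve-∀
          id₄ : ∀ B a b A u t w g ξ →
            ((u + t) * w + ξ) * b + (B * (u * a) + ((u + t) * (B * g) + (b * (t * A) + t * (a * B))))
            ≡ B * ((u + t) * g) + ((u + t) * (B * a + w * b) + (b * ξ + t * (b * A)))
          id₄ = solve-∀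

  AtLeast : (A B a b f g : ℕ) → Set
  AtLeast A B a b f g = ∀ u v → u ≤ v → v * A + u * B ≤ v * f → v * a + u * b ≤ v * g

  -- The arithmetic of one induction step. Index 0 belongs to sets whose complement avoids the
  -- removed point, or to shadow sets avoiding it, and index 1 to those containing it; A, B, D stand
  -- for `C z (suc k)`, `C z k`, `C⁻ z k`, and a, b, d for the same with s. I₁ and I₂ bound g₀
  -- through f₀ at z + 1 and z; I₃, I₅ and I₆ bound g₁ through f₁; I₄ is the cross bound of g₀
  -- through f₁. A deficit of one half is made up by the other because the slopes satisfy d / D ≤ b
  -- / B.
  chord-step : ∀ {A B D a b d f₀ f₁ g₀ g₁} → B * d ≤ D * b → 0 < B → 0 < A ⊎ B ≡ 1 →
    AtLeast (A + B) (B + D) (a + b) (b + d) f₀ g₀ →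
    (0 < A → AtLeast A B a b f₀ g₀) →
    AtLeast B D b d f₁ g₁ →
    AtLeast B D a b f₁ g₀ →
    (∀ u v → u ≤ v → u * B ≤ v * f₁ → u * b ≤ v * g₁) →
    (∀ u v → u ≤ v → u * (B + D) ≤ v * f₁ → u * (b + d) ≤ v * g₁) →
    AtLeast (A + B) (B + D) (a + b) (b + d) (f₀ + f₁) (g₀ + g₁)
  chord-step {A} {B} {D} {a} {b} {d} {f₀} {f₁} {g₀} {g₁} Bd≤Db 0<B A>0⊎B≡1 I₁ I₂ I₃ I₄ I₅ I₆ u v u≤v h with A + B ≤? f₀
  chord-step {A} {B} {D} {a} {b} {d} {_} {f₁} {g₀} {g₁} Bd≤Db 0<B A>0⊎B≡1 I₁ I₂ I₃ I₄ I₅ I₆ u v u≤v h | yes A+B≤f₀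
    with m≤n⇒∃[o]m+o≡n A+B≤f₀
  -- f₀ passes the start of the target chord by w. Either this already reaches θ, or I₁ is applied
  -- at w / (B + D) and the missing t / v is supplied by f₁ along the ray I₆.
  ... | w , refl with ≤-total (u * (B + D)) (v * w)
  ... | inj₁ uP≤vw = ≤-trans (I₁ u v u≤v (≤-by _ _ 0 uP≤vw (id₁ A B D u v w))) (*-monoʳ-≤ v (m≤m+n g₀ g₁))
    where
    id₁ : ∀ A B D u v w → v * (A + B) + u * (B + D) + v * w + 0 ≡ v * (A + B + w) + u * (B + D)
    id₁ = solve-∀
  ... | inj₂ vw≤uP with m≤n⇒∃[o]m+o≡n vw≤uP
  ... | t , eq with w ≤? B + D
  ...   | no w≰P = ≤-trans (I₁ u v u≤v (≤-by _ _ 0 (≤-trans (*-monoˡ-≤ (B + D) u≤v) (*-monoʳ-≤ v (<⇒≤ (≰⇒> w≰P)))) (id₁ A B D u v w)))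
                   (*-monoʳ-≤ v (m≤m+n g₀ g₁))
    where
    id₁ : ∀ A B D u v w → v * (A + B) + u * (B + D) + v * w + 0 ≡ v * (A + B + w) + u * (B + D)
    id₁ = solve-∀
  ...   | yes w≤P = *-cancelˡ-≤ (B + D) {{>-nonZero (≤-trans 0<B (m≤m+n B D))}} (≤-by _ _ 0
            (+-mono-≤ (*-monoʳ-≤ v (I₁ w (B + D) w≤P (≤-reflexive (id₁ A B D w))))
                      (I₆ t (v * (B + D)) t≤vP (subst (t * (B + D) ≤_) (id₂ v f₁ (B + D)) (*-monoˡ-≤ (B + D) t≤vf₁))))
            (trans (id₃ B D a b d u v w t g₀ g₁) (trans (cong (λ e → (b + d) * e + ((B + D) * (v * (a + b)) + (v * ((B + D) * g₀) + v * (B + D) * g₁))) (sym eq)) (id₄ B D a b d v w t g₀ g₁))))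
    where
    t≤vP : t ≤ v * (B + D)
    t≤vP = ≤-trans (≤-trans (m≤n+m t (v * w)) (≤-reflexive eq)) (*-monoˡ-≤ (B + D) u≤v)
    id₁ : ∀ A B D w → (B + D) * (A + B) + w * (B + D) ≡ (B + D) * (A + B + w)
    id₁ = solve-∀
    id₂ : ∀ v f P → v * f * P ≡ v * P * f
    id₂ = solve-∀
    t≤vf₁ : t ≤ v * f₁
    t≤vf₁ = ≤-by _ _ 0 h (trans (id₅ t v A B w f₁) (trans (cong (λ e → e + (v * (A + B) + v * f₁)) eq) (id₆ u v A B D f₁)))
      where
      id₅ : ∀ t v A B w f₁ → t + v * (A + B + w + f₁) + 0 ≡ (v * w + t) + (v * (A + B) + v * f₁)
      id₅ = solve-∀
      id₆ : ∀ u v A B D f₁ → u * (B + D) + (v * (A + B) + v * f₁) ≡ v * f₁ + (v * (A + B) + u * (B + D))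
      id₆ = solve-∀
    id₃ : ∀ B D a b d u v w t g₀ g₁ →
      (B + D) * (v * (a + b) + u * (b + d)) + (v * ((B + D) * g₀) + v * (B + D) * g₁) + 0
      ≡ (b + d) * (u * (B + D)) + ((B + D) * (v * (a + b)) + (v * ((B + D) * g₀) + v * (B + D) * g₁))
    id₃ = solve-∀
    id₄ : ∀ B D a b d v w t g₀ g₁ →
      (b + d) * (v * w + t) + ((B + D) * (v * (a + b)) + (v * ((B + D) * g₀) + v * (B + D) * g₁))
      ≡ (B + D) * (v * (g₀ + g₁)) + (v * ((B + D) * (a + b) + w * (b + d)) + t * (b + d))
    id₄ = solve-∀
  chord-step {A} {B} {D} {a} {b} {d} {f₀} {f₁} {g₀} {g₁} Bd≤Db 0<B A>0⊎B≡1 I₁ I₂ I₃ I₄ I₅ I₆ u v u≤v h | no A+B≰f₀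
    with v * B + u * D ≤? v * f₁
  -- f₁ reaches B + θ D and so bounds both halves of the shadow at the same θ.
  ... | yes hyp = subst₂ _≤_ (id₁ a b d u v) (id₂ g₀ g₁ v) (+-mono-≤ (I₃ u v u≤v hyp) (I₄ u v u≤v hyp))
    where
    id₁ : ∀ a b d u v → v * b + u * d + (v * a + u * b) ≡ v * (a + b) + u * (b + d)
    id₁ = solve-∀
    id₂ : ∀ g₀ g₁ v → v * g₁ + v * g₀ ≡ v * (g₀ + g₁)
    id₂ = solve-∀
  ... | no ¬hyp = split A<f₀
    where
    vf₁< : v * f₁ < v * B + u * D
    vf₁< = ≰⇒> ¬hyp
    vA+uB< : v * A + u * B < v * f₀
    vA+uB< = +-cancelʳ-< (v * B + u * D) _ _ (begin-strict
      v * A + u * B + (v * B + u * D)  ≡⟨ id₁ A B D u v ⟩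
      v * (A + B) + u * (B + D)        ≤⟨ h ⟩
      v * (f₀ + f₁)                    ≡⟨ *-distribˡ-+ v f₀ f₁ ⟩
      v * f₀ + v * f₁                  <⟨ +-monoʳ-< (v * f₀) vf₁< ⟩
      v * f₀ + (v * B + u * D)         ∎)
      where
      open ≤-Reasoning
      id₁ : ∀ A B D u v → v * A + u * B + (v * B + u * D) ≡ v * (A + B) + u * (B + D)
      id₁ = solve-∀
    A<f₀ : A < f₀
    A<f₀ = *-cancelˡ-< v A f₀ (≤-<-trans (m≤m+n (v * A) (u * B)) vA+uB<)
    split : A < f₀ → v * (a + b) + u * (b + d) ≤ v * (g₀ + g₁)
    split _ with m≤n⇒∃[o]m+o≡n (<⇒≤ A<f₀)
    ... | w , refl = main (≤-total f₁ B)
      where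
      w<B : w < B
      w<B = +-cancelˡ-< A w B (≰⇒> A+B≰f₀)
      A>0 : 0 < A ⊎ B ≡ 1 → 0 < A
      A>0 (inj₁ p)    = p
      -- For B = 1 no integer lies strictly between A and A + B, so f₀ could not be there.
      A>0 (inj₂ refl) = contradiction (subst₂ _<_ (sym (+-identityʳ A)) (cong (A +_) (n<1⇒n≡0 w<B)) A<f₀) (<-irrefl refl)
      J₂ : B * a + w * b ≤ B * g₀
      J₂ = I₂ (A>0 A>0⊎B≡1) w B (<⇒≤ w<B) (≤-reflexive (id₀ A B w))
        where
        id₀ : ∀ A B w → B * A + w * B ≡ B * (A + w)
        id₀ = solve-∀
      main : f₁ ≤ B ⊎ B ≤ f₁ → v * (a + b) + u * (b + d) ≤ v * (g₀ + g₁)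
      -- The chord of f₀ and the ray of f₁ both have slope b / B, so only w + f₁ ≥ B + θ (B + D)
      -- counts; the part θ D is credited at b / B, which is at least d / D.
      main (inj₁ f₁≤B) = *-cancelˡ-≤ B {{>-nonZero 0<B}} (≤-by _ _ 0
          (+-mono-≤ (*-monoʳ-≤ v J₂) (+-mono-≤ (*-monoʳ-≤ v (I₅ f₁ B f₁≤B (≤-reflexive (*-comm f₁ B))))
            (+-mono-≤ (*-monoʳ-≤ b h) (*-monoʳ-≤ u Bd≤Db))))
          (id₁ A B D a b d u v w f₁ g₀ g₁))
        where
        id₁ : ∀ A B D a b d u v w f₁ g₀ g₁ →
          B * (v * (a + b) + u * (b + d)) + (v * (B * g₀) + (v * (B * g₁) + (b * (v * (A + w + f₁)) + u * (D * b)))) + 0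
          ≡ B * (v * (g₀ + g₁)) + (v * (B * a + w * b) + (v * (f₁ * b) + (b * (v * (A + B) + u * (B + D)) + u * (B * d))))
        id₁ = solve-∀
      -- f₁ = B + y falls short of B + θ D by ξ / v. The half f₀ makes this up, at slope b / B
      -- instead of d / D.
      main (inj₂ B≤f₁) with m≤n⇒∃[o]m+o≡n B≤f₁
      ... | y , refl with m≤n⇒∃[o]m+o≡n (<⇒≤ vy<uD)
        where
        vy<uD : v * y < u * D
        vy<uD = +-cancelˡ-< (v * B) _ _ (subst (_< v * B + u * D) (*-distribˡ-+ v B y) vf₁<)
      ... | ξ , eq = *-cancelˡ-≤ (B * D) {{>-nonZero (*-mono-≤ 0<B (≤-<-trans z≤n y<D))}} (≤-by _ _ 0
          (+-mono-≤ (*-monoʳ-≤ (v * D) J₂) (+-mono-≤ (*-monoʳ-≤ (v * B) J₃)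
            (+-mono-≤ (*-monoʳ-≤ (D * b) uB+ξ≤vw) (*-monoʳ-≤ ξ Bd≤Db))))
          (trans (id₂ B D a b d u v w ξ g₀ g₁) (trans (cong (λ e → B * d * e + R) (sym eq)) (id₃ B D a b d u v w y ξ g₀ g₁))))
        where
        R = B * D * (v * (a + b) + u * b) + (v * D * (B * g₀) + (v * B * (D * g₁) + (D * b * (v * w) + ξ * (D * b))))
        vy<uD : v * y < u * D
        vy<uD = +-cancelˡ-< (v * B) _ _ (subst (_< v * B + u * D) (*-distribˡ-+ v B y) vf₁<)
        y<D : y < D
        y<D = *-cancelˡ-< v y D (<-≤-trans vy<uD (*-monoˡ-≤ D u≤v))
        J₃ : D * b + y * d ≤ D * g₁
        J₃ = I₃ y D (<⇒≤ y<D) (≤-reflexive (id₀ B D y))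
          where
          id₀ : ∀ B D y → D * B + y * D ≡ D * (B + y)
          id₀ = solve-∀
        uB+ξ≤vw : u * B + ξ ≤ v * w
        uB+ξ≤vw = ≤-by _ _ 0 h (trans (id₄ A B u v w y ξ) (trans (cong (λ e → e + (u * B + v * (A + w + B))) eq) (id₅ A B D u v w)))
          where
          id₄ : ∀ A B u v w y ξ → u * B + ξ + v * (A + w + (B + y)) + 0 ≡ v * y + ξ + (u * B + v * (A + w + B))
          id₄ = solve-∀
          id₅ : ∀ A B D u v w → u * D + (u * B + v * (A + w + B)) ≡ v * w + (v * (A + B) + u * (B + D))
          id₅ = solve-∀
        id₂ : ∀ B D a b d u v w ξ g₀ g₁ →
          B * D * (v * (a + b) + u * (b + d)) + (v * D * (B * g₀) + (v * B * (D * g₁) + (D * b * (v * w) + ξ * (D * b)))) + 0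
          ≡ B * d * (u * D) + (B * D * (v * (a + b) + u * b) + (v * D * (B * g₀) + (v * B * (D * g₁) + (D * b * (v * w) + ξ * (D * b)))))
        id₂ = solve-∀
        id₃ : ∀ B D a b d u v w y ξ g₀ g₁ →
          B * d * (v * y + ξ) + (B * D * (v * (a + b) + u * b) + (v * D * (B * g₀) + (v * B * (D * g₁) + (D * b * (v * w) + ξ * (D * b)))))
          ≡ B * D * (v * (g₀ + g₁)) + (v * D * (B * a + w * b) + (v * B * (D * b + y * d) + (D * b * (u * B + ξ) + ξ * (B * d))))
        id₃ = solve-∀

  -- Sums over the power set, split at a coordinate.

  ∑ : ∀ {n} → (Subset n → ℕ) → ℕ
  ∑ {zero}  f = f []
  ∑ {suc n} f = ∑ (f ∘ (outside ∷_)) + ∑ (f ∘ (inside ∷_))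

  𝟙 : Bool → ℕ
  𝟙 b = if b then 1 else 0

  count : ∀ {n} → (Subset n → Bool) → ℕ
  count P = ∑ (𝟙 ∘ P)

  ∑-mono : ∀ {n} {f g : Subset n → ℕ} → (∀ X → f X ≤ g X) → ∑ f ≤ ∑ g
  ∑-mono {zero}  f≤g = f≤g []
  ∑-mono {suc n} f≤g = +-mono-≤ (∑-mono (f≤g ∘ (outside ∷_))) (∑-mono (f≤g ∘ (inside ∷_)))

  ∑-cong : ∀ {n} {f g : Subset n → ℕ} → (∀ X → f X ≡ g X) → ∑ f ≡ ∑ g
  ∑-cong f≡g = ≤-antisym (∑-mono (≤-reflexive ∘ f≡g)) (∑-mono (≤-reflexive ∘ sym ∘ f≡g))

  ∑-+ : ∀ {n} (f g : Subset n → ℕ) → ∑ (λ X → f X + g X) ≡ ∑ f + ∑ g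
  ∑-+ {zero}  f g = refl
  ∑-+ {suc n} f g = trans (cong₂ _+_ (∑-+ (f ∘ (outside ∷_)) _) (∑-+ (f ∘ (inside ∷_)) _))
                            (interchange (∑ (f ∘ (outside ∷_))) (∑ (g ∘ (outside ∷_))) _ _)

  ∑-0 : ∀ n → ∑ {n} (λ _ → 0) ≡ 0
  ∑-0 zero    = refl
  ∑-0 (suc n) = cong₂ _+_ (∑-0 n) (∑-0 n)

  term≤∑ : ∀ {n} (f : Subset n → ℕ) X → f X ≤ ∑ f
  term≤∑ f []            = ≤-refl
  term≤∑ f (outside ∷ X) = ≤-trans (term≤∑ (f ∘ (outside ∷_)) X) (m≤m+n _ _)
  term≤∑ f (inside ∷ X)  = ≤-trans (term≤∑ (f ∘ (inside ∷_)) X) (m≤n+m _ _)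

  ∑-∁ : ∀ {n} (f : Subset n → ℕ) → ∑ (f ∘ ∁) ≡ ∑ f
  ∑-∁ {zero}  f = refl
  ∑-∁ {suc n} f = trans (cong₂ _+_ (∑-∁ (f ∘ (inside ∷_))) (∑-∁ (f ∘ (outside ∷_)))) (+-comm (∑ (f ∘ (inside ∷_))) _)

  ∑-insertAt : ∀ {n} (x : Fin (suc n)) (f : Subset (suc n) → ℕ) →
               ∑ f ≡ ∑ (λ X → f (insertAt X x outside)) + ∑ (λ X → f (insertAt X x inside))
  ∑-insertAt         zero    f = refl
  ∑-insertAt {suc n} (suc x) f =
    trans (cong₂ _+_ (∑-insertAt x (f ∘ (outside ∷_))) (∑-insertAt x (f ∘ (inside ∷_))))
          (interchange (∑ λ X → f (outside ∷ insertAt X x outside)) _ _ _)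

  𝟙-mono : ∀ {b c} → (b ≡ true → c ≡ true) → 𝟙 b ≤ 𝟙 c
  𝟙-mono {false} h = z≤n
  𝟙-mono {true}  h rewrite h refl = ≤-refl

  count-mono : ∀ {n} {P Q : Subset n → Bool} → (∀ X → P X ≡ true → Q X ≡ true) → count P ≤ count Q
  count-mono h = ∑-mono (λ X → 𝟙-mono (h X))

  count>0⇒∃ : ∀ {n} (P : Subset n → Bool) → 0 < count P → ∃[ X ] P X ≡ true
  count>0⇒∃ {zero} P h with P [] in eq
  ... | true = [] , eq
  count>0⇒∃ {suc n} P h with 1 ≤? count (P ∘ (outside ∷_))
  ... | yes p = let X , PX = count>0⇒∃ _ p in outside ∷ X , PX
  ... | no ¬p = 
        let X , PX = count>0⇒∃ (P ∘ (inside ∷_)) (subst (λ e → 0 < e + count (P ∘ (inside ∷_))) (n<1⇒n≡0 (≰⇒> ¬p)) h) in inside ∷ X , PX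

  ∃⇒count>0 : ∀ {n} (P : Subset n → Bool) X → P X ≡ true → 0 < count P
  ∃⇒count>0 P X PX = ≤-trans (≤-reflexive (sym (cong 𝟙 PX))) (term≤∑ (𝟙 ∘ P) X)

  Disjoint-∷ : ∀ {n} a b (X Y : Subset n) → a ∧ b ≡ false → Disjoint X Y → Disjoint (a ∷ X) (b ∷ Y)
  Disjoint-∷ a b X Y eq dis (zero , p) with a ∧ b
  Disjoint-∷ a b X Y () dis (zero , here) | _
  Disjoint-∷ a b X Y eq dis (suc i , there p) = dis (i , p)

  Disjoint-head : ∀ {n} a b (X Y : Subset n) → Disjoint (a ∷ X) (b ∷ Y) → a ∧ b ≡ false
  Disjoint-head false b     X Y dis = refl
  Disjoint-head true  false X Y dis = refl
  Disjoint-head true  true  X Y dis = contradiction (zero , here) dis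

  Disjoint-insertAt : ∀ {n} (x : Fin (suc n)) a b (X Y : Subset n) → a ∧ b ≡ false → Disjoint X Y →
                      Disjoint (insertAt X x a) (insertAt Y x b)
  Disjoint-insertAt zero    a b X       Y       eq dis = Disjoint-∷ a b X Y eq dis
  Disjoint-insertAt (suc x) a b (c ∷ X) (d ∷ Y) eq dis =
    Disjoint-∷ c d _ _ (Disjoint-head c d X Y dis) (Disjoint-insertAt x a b X Y eq (λ { (i , p) → dis (suc i , there p) }))

  ∣insertAt-inside∣ : ∀ {n} (X : Subset n) x → ∣ insertAt X x inside ∣ ≡ suc ∣ X ∣
  ∣insertAt-inside∣ X             zero    = refl
  ∣insertAt-inside∣ (outside ∷ X) (suc x) = ∣insertAt-inside∣ X x
  ∣insertAt-inside∣ (inside ∷ X)  (suc x) = cong suc (∣insertAt-inside∣ X x)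

  ∣insertAt-outside∣ : ∀ {n} (X : Subset n) x → ∣ insertAt X x outside ∣ ≡ ∣ X ∣
  ∣insertAt-outside∣ X             zero    = refl
  ∣insertAt-outside∣ (outside ∷ X) (suc x) = ∣insertAt-outside∣ X x
  ∣insertAt-outside∣ (inside ∷ X)  (suc x) = cong suc (∣insertAt-outside∣ X x)

  -- Kruskal-Katona by induction on the ground set.

  Chord-empty : ∀ {z k s g} → k ≤ z → Chord z k s 0 g
  Chord-empty {z} {k} k≤z u zero    z≤n h = z≤n
  Chord-empty {z} {k} k≤z u (suc v) u≤v h =
    contradiction (≤-trans (*-mono-≤ (z<s {v}) (C>0 k≤z)) (≤-trans (m≤m+n _ _) (≤-trans h (≤-reflexive (*-zeroʳ v))))) (<-irrefl refl)

  -- G plays the role of the s-shadow of the family of complements of members of F.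
  Covers : ∀ {m} → ℕ → (F G : Subset m → Bool) → Set
  Covers s F G = ∀ X Y → F X ≡ true → ∣ Y ∣ ≡ s → Disjoint X Y → G Y ≡ true

  -- The first point is split off. Sets missing it (`F₁`) force sets into `G₁` and also, one level
  -- higher, into `G₀`; this second contribution takes the place of compression. It needs s < k, so
  -- s = k is separate: there complementation injects F into G.
  kruskal-katona-chord : ∀ m {k s} (F G : Subset m → Bool) → s ≤ k →
    (∀ X → F X ≡ true → ∣ ∁ X ∣ ≡ k) → Covers s F G →
    ∀ z → k ≤ z → Chord z k s (count F) (count G)
  kruskal-katona-chord m {k} {s} F G s≤k size cov z k≤z with m≤n⇒m<n∨m≡n s≤k
  ... | inj₂ refl = λ u v u≤v h → ≤-trans h (*-monoʳ-≤ v (≤-trans (≤-reflexive (sym (∑-∁ (𝟙 ∘ F)))) (count-mono member)))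
    where
    ∁∁ : ∀ {m} (X : Subset m) → ∁ (∁ X) ≡ X
    ∁∁ []            = refl
    ∁∁ (outside ∷ X) = cong (outside ∷_) (∁∁ X)
    ∁∁ (inside ∷ X)  = cong (inside ∷_) (∁∁ X)
    member : ∀ X → F (∁ X) ≡ true → G X ≡ true
    member X FX = cov (∁ X) X FX (trans (cong ∣_∣ (sym (∁∁ X))) (size (∁ X) FX))
      (λ { (i , p) → let q , r = x∈p∩q⁻ (∁ X) X p in x∈p⇒x∉∁p r q })
  kruskal-katona-chord m {suc k} {zero} F G s≤k size cov z k≤z | inj₁ _ with 1 ≤? count F
  ... | no ¬p = subst (λ f → Chord z (suc k) 0 f (count G)) (sym (n<1⇒n≡0 (≰⇒> ¬p))) (Chord-empty {s = zero} k≤z)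
  -- At s = 0 the shadow is the empty set alone, and `C z 0` = 1, `C⁻ z 0` = 0 ask for no more.
  ... | yes p = λ u v u≤v h → subst (_≤ v * count G) (trans (sym (+-identityʳ (v * 1))) (cong (v * 1 +_) (sym (*-zeroʳ u)))) (*-monoʳ-≤ v 0<G)
    where
    0<G : 0 < count G
    0<G = let X , FX = count>0⇒∃ F p in
          ∃⇒count>0 G ⊥ (cov X ⊥ FX (∣⊥∣≡0 m) (λ { (i , q) → ∉⊥ (proj₂ (x∈p∩q⁻ X ⊥ q)) }))
  kruskal-katona-chord zero {suc k} {suc s} F G s≤k size cov z k≤z | inj₁ _ with F [] in eq
  ... | false = Chord-empty k≤z
  ... | true  = contradiction (size [] eq) λ ()
  kruskal-katona-chord (suc m) {suc k} {suc s} F G s≤k size cov (suc z) (s≤s k≤z) | inj₁ (s≤s s<k) =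
    subst₂ (λ f g → Chord (suc z) (suc k) (suc s) f g) (+-comm f₀ f₁) refl step
    where
    F₀ = F ∘ (inside ∷_)
    F₁ = F ∘ (outside ∷_)
    G₀ = G ∘ (outside ∷_)
    G₁ = G ∘ (inside ∷_)
    f₀ = count F₀
    f₁ = count F₁
    size₀ : ∀ X → F₀ X ≡ true → ∣ ∁ X ∣ ≡ suc k
    size₀ X = size (inside ∷ X)
    size₁ : ∀ X → F₁ X ≡ true → ∣ ∁ X ∣ ≡ k
    size₁ X FX = suc-injective (size (outside ∷ X) FX)
    c₀₀ : Covers (suc s) F₀ G₀
    c₀₀ X Y FX ∣Y∣ dis = cov (inside ∷ X) (outside ∷ Y) FX ∣Y∣ (Disjoint-∷ inside outside X Y refl dis)
    c₁₁ : Covers s F₁ G₁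
    c₁₁ X Y FX ∣Y∣ dis = cov (outside ∷ X) (inside ∷ Y) FX (cong suc ∣Y∣) (Disjoint-∷ outside inside X Y refl dis)
    c₁₀ : Covers (suc s) F₁ G₀
    c₁₀ X Y FX ∣Y∣ dis = cov (outside ∷ X) (outside ∷ Y) FX ∣Y∣ (Disjoint-∷ outside outside X Y refl dis)
    ch₁₁ : ∀ z → k ≤ z → Chord z k s f₁ (count G₁)
    ch₁₁ = kruskal-katona-chord m F₁ G₁ (<⇒≤ s<k) size₁ c₁₁
    ch₀₀ : ∀ z → suc k ≤ z → Chord z (suc k) (suc s) f₀ (count G₀)
    ch₀₀ = kruskal-katona-chord m F₀ G₀ s≤k size₀ c₀₀
    -- The chord for `F₀` at z requires k + 1 ≤ z. The one exception z = k is the case B = 1.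
    A>0⊎B≡1 : 0 < C z (suc k) ⊎ C z k ≡ 1
    A>0⊎B≡1 with m≤n⇒m<n∨m≡n k≤z
    ... | inj₁ k<z  = inj₁ (C>0 k<z)
    ... | inj₂ refl = inj₂ (C-diag k)
    k<z : 0 < C z (suc k) → suc k ≤ z
    k<z pos with suc k ≤? z
    ... | yes p = p
    ... | no ¬p = contradiction (subst (0 <_) (C>n (≰⇒> ¬p)) pos) (<-irrefl refl)
    pk = C-pascal z k
    ps = C-pascal z s
    step : Chord (suc z) (suc k) (suc s) (f₀ + f₁) (count G)
    step = subst₂ (λ P p → AtLeast (C z (suc k) + C z k) P (C z (suc s) + C z s) p (f₀ + f₁) (count G)) (sym pk) (sym ps)
      (chord-step {C z (suc k)} {C z k} {C⁻ z k} {C z (suc s)} {C z s} {C⁻ z s} {f₀} {f₁} {count G₀} {count G₁}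
        (subst₂ _≤_ (*-comm (C⁻ z s) _) (*-comm (C z s) _) (C⁻-log-concave z (<⇒≤ s<k)))
        (C>0 k≤z) A>0⊎B≡1
        (subst₂ (λ P p → AtLeast (C z (suc k) + C z k) P (C z (suc s) + C z s) p f₀ (count G₀)) pk ps (ch₀₀ (suc z) (s≤s k≤z)))
        (λ pos → ch₀₀ z (k<z pos))
        (ch₁₁ z k≤z)
        (kruskal-katona-chord m F₁ G₀ s<k size₁ c₁₀ z k≤z)
        (chord⇒linear (<⇒≤ s<k) ch₁₁ z k≤z)
        (subst₂ (λ P p → ∀ u v → u ≤ v → u * P ≤ v * f₁ → u * p ≤ v * count G₁) pk ps
          (chord⇒linear (<⇒≤ s<k) ch₁₁ (suc z) (m≤n⇒m≤1+n k≤z))))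

  kruskal-katona-linear : ∀ m {k s} (F G : Subset m → Bool) → s ≤ k →
    (∀ X → F X ≡ true → ∣ ∁ X ∣ ≡ k) → Covers s F G →
    ∀ z → k ≤ z → Linear z k s (count F) (count G)
  kruskal-katona-linear m F G s≤k size cov = chord⇒linear s≤k (kruskal-katona-chord m F G s≤k size cov)

  -- Families and their codegrees

  _≟ˢ_ : ∀ {n} (X Y : Subset n) → Dec (X ≡ Y)
  _≟ˢ_ = Vec-≡-dec _≟ᵇ_

  module _ {n : ℕ} where
    open import Data.List.Membership.DecPropositional (_≟ˢ_ {n}) public using (_∈?_)

  does⇒ : ∀ {P : Set} (P? : Dec P) → does P? ≡ true → P
  does⇒ (yes p) _ = p

  χ : ∀ {n} → Family n → Subset n → Bool
  χ F X = does (X ∈? F)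

  weight : ∀ {n} → (Subset n → ℕ) → Family n → ℕ
  weight f F = sum (map f F)

  ∑-single : ∀ {n} (Y : Subset n) (f : Subset n → ℕ) → ∑ (λ X → 𝟙 (does (X ≟ˢ Y)) * f X) ≡ f Y
  ∑-single []            f = +-identityʳ (f [])
  ∑-single {suc n} (outside ∷ Y) f = trans (cong₂ _+_ (∑-single Y (λ X → f (outside ∷ X))) (∑-0 n)) (+-identityʳ _)
  ∑-single {suc n} (inside ∷ Y)  f = cong₂ _+_ (∑-0 n) (∑-single Y (λ X → f (inside ∷ X)))

  𝟙-∈? : ∀ {n} {Y : Subset n} {F} → All (λ Z → ¬ Y ≡ Z) F → ∀ X → 𝟙 (χ (Y ∷ F) X) ≡ 𝟙 (does (X ≟ˢ Y)) + 𝟙 (χ F X)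
  𝟙-∈? {Y = Y} {F} Y∉F X with X ≟ˢ Y
  ... | no  _    = refl
  ... | yes refl = cong (λ b → 1 + 𝟙 b) (sym (dec-false (X ∈? F) (λ X∈F → All.lookup Y∉F X∈F refl)))

  -- The bridge between lists, in which `e` and `ℓ` are defined, and indicator functions, on which
  -- the shadow induction runs.
  weight-χ : ∀ {n} {F : Family n} → Unique F → (f : Subset n → ℕ) → ∑ (λ X → 𝟙 (χ F X) * f X) ≡ weight f F
  weight-χ {n} {[]}    []           f = ∑-0 n
  weight-χ {n} {Y ∷ F} (Y∉F ∷ uniq) f = begin
    ∑ (λ X → 𝟙 (χ (Y ∷ F) X) * f X)                                    ≡⟨ ∑-cong (λ X → trans (cong (_* f X) (𝟙-∈? Y∉F X)) (*-distribʳ-+ (f X) (𝟙 (does (X ≟ˢ Y))) _)) ⟩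
    ∑ (λ X → 𝟙 (does (X ≟ˢ Y)) * f X + 𝟙 (χ F X) * f X)               ≡⟨ ∑-+ (λ X → 𝟙 (does (X ≟ˢ Y)) * f X) _ ⟩
    ∑ (λ X → 𝟙 (does (X ≟ˢ Y)) * f X) + ∑ (λ X → 𝟙 (χ F X) * f X)     ≡⟨ cong₂ _+_ (∑-single Y f) (weight-χ uniq f) ⟩
    f Y + weight f F                                                    ∎
    where open ≡-Reasoning

  weight-1 : ∀ {n} (F : Family n) → weight (λ _ → 1) F ≡ length F
  weight-1 []      = refl
  weight-1 (X ∷ F) = cong suc (weight-1 F)

  weight-+ : ∀ {n} (f g : Subset n → ℕ) F → weight (λ X → f X + g X) F ≡ weight f F + weight g F
  weight-+ f g []      = refl
  weight-+ f g (X ∷ F) = trans (cong (f X + g X +_) (weight-+ f g F)) (interchange (f X) (g X) (weight f F) (weight g F))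

  weight-mono : ∀ {n} {f g : Subset n → ℕ} → (∀ X → f X ≤ g X) → ∀ F → weight f F ≤ weight g F
  weight-mono f≤g []      = z≤n
  weight-mono f≤g (X ∷ F) = +-mono-≤ (f≤g X) (weight-mono f≤g F)

  section : ∀ {n} → Bool → Fin (suc n) → Family (suc n) → Subset n → Bool
  section b x F X = χ F (insertAt X x b)

  deg codeg : ∀ {n} → Fin n → Family n → ℕ
  deg   x = weight (λ X → 𝟙 (lookup X x))
  codeg x = weight (λ X → 𝟙 (not (lookup X x)))

  deg+codeg : ∀ {n} (x : Fin n) F → deg x F + codeg x F ≡ length F
  deg+codeg x F = trans (sym (weight-+ _ _ F)) (trans (cong sum (map-cong x F)) (weight-1 F))
    where
    map-cong : ∀ {n} (x : Fin n) (F : Family n) → map (λ X → 𝟙 (lookup X x) + 𝟙 (not (lookup X x))) F ≡ map (λ _ → 1) F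
    map-cong x []      = refl
    map-cong x (X ∷ F) with lookup X x
    ... | true  = cong (1 ∷_) (map-cong x F)
    ... | false = cong (1 ∷_) (map-cong x F)

  count-section-inside : ∀ {n} {F : Family (suc n)} → Unique F → ∀ x → count (section inside x F) ≡ deg x F
  count-section-inside {n} {F} uniq x = begin
    count (section inside x F)                                           ≡⟨ ∑-cong (λ X → sym (inside-1 X)) ⟩
    ∑ (λ X → h (insertAt X x inside))                                    ≡⟨ cong (_+ ∑ (λ X → h (insertAt X x inside))) (trans (∑-cong outside-0) (∑-0 n)) ⟨
    ∑ (λ X → h (insertAt X x outside)) + ∑ (λ X → h (insertAt X x inside)) ≡⟨ ∑-insertAt x h ⟨
    ∑ h                                                                  ≡⟨ weight-χ uniq _ ⟩
    deg x F                                                              ∎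
    where
    open ≡-Reasoning
    h : Subset (suc n) → ℕ
    h X = 𝟙 (χ F X) * 𝟙 (lookup X x)
    outside-0 : ∀ X → h (insertAt X x outside) ≡ 0
    outside-0 X = trans (cong (λ b → 𝟙 (section outside x F X) * 𝟙 b) (insertAt-lookup X x outside))
                        (*-zeroʳ (𝟙 (section outside x F X)))
    inside-1 : ∀ X → h (insertAt X x inside) ≡ 𝟙 (section inside x F X)
    inside-1 X = trans (cong (λ b → 𝟙 (section inside x F X) * 𝟙 b) (insertAt-lookup X x inside)) (*-identityʳ _)

  count-section-outside : ∀ {n} {F : Family (suc n)} → Unique F → ∀ x → count (section outside x F) ≡ codeg x F
  count-section-outside {n} {F} uniq x = +-cancelˡ-≡ (deg x F) _ _ (begin
    deg x F + count (section outside x F)                          ≡⟨ cong (_+ count (section outside x F)) (count-section-inside uniq x) ⟨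
    count (section inside x F) + count (section outside x F)       ≡⟨ +-comm (count (section inside x F)) _ ⟩
    count (section outside x F) + count (section inside x F)       ≡⟨ ∑-insertAt x (λ X → 𝟙 (χ F X)) ⟨
    ∑ (λ X → 𝟙 (χ F X))                                            ≡⟨ ∑-cong (λ X → sym (*-identityʳ (𝟙 (χ F X)))) ⟩
    ∑ (λ X → 𝟙 (χ F X) * 1)                                        ≡⟨ weight-χ uniq _ ⟩
    weight (λ _ → 1) F                                             ≡⟨ weight-1 F ⟩
    length F                                                       ≡⟨ deg+codeg x F ⟨
    deg x F + codeg x F                                            ∎)
    where open ≡-Reasoning

  count-layer : ∀ m s → count {m} (λ Y → does (∣ Y ∣ ≟ s)) ≡ C m s
  count-layer zero    zero    = refl
  count-layer zero    (suc s) = refl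
  count-layer (suc m) zero    = cong₂ _+_ (count-layer m zero) (∑-0 m)
  count-layer (suc m) (suc s) = cong₂ _+_ (count-layer m (suc s)) (count-layer m s)

  χ⇒∈ : ∀ {n} {F : Family n} {X} → χ F X ≡ true → X ∈ F
  χ⇒∈ {F = F} {X} = does⇒ (X ∈? F)

  Uniform : ∀ {n} → ℕ → Family n → Set
  Uniform r = All (λ X → ∣ X ∣ ≡ r)

  colink : ∀ {m} → ℕ → Fin (suc m) → Family (suc m) → Subset m → Bool
  colink s x F Y = does (∣ Y ∣ ≟ s) ∧ not (section inside x F Y)

  -- Uniformity puts every Y whose extension by x lies in F into the layer of size s, so these Y and
  -- the `colink` partition that layer.
  count-colink : ∀ {m s} {F : Family (suc m)} → Unique F → Uniform (suc s) F → ∀ x →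
                 count (colink s x F) + deg x F ≡ C m s
  count-colink {m} {s} {F} uniq unif x = begin
    count (colink s x F) + deg x F                                    ≡⟨ cong (count (colink s x F) +_) (count-section-inside uniq x) ⟨
    count (colink s x F) + count (section inside x F)                 ≡⟨ ∑-+ (λ Y → 𝟙 (colink s x F Y)) _ ⟨
    ∑ (λ Y → 𝟙 (colink s x F Y) + 𝟙 (section inside x F Y))          ≡⟨ ∑-cong pt ⟩
    count {m} (λ Y → does (∣ Y ∣ ≟ s))                                 ≡⟨ count-layer m s ⟩
    C m s                                                             ∎
    where
    open ≡-Reasoning
    pt : ∀ Y → 𝟙 (colink s x F Y) + 𝟙 (section inside x F Y) ≡ 𝟙 (does (∣ Y ∣ ≟ s))
    pt Y with section inside x F Y in eq
    ... | true rewrite dec-true (∣ Y ∣ ≟ s) (suc-injective (trans (sym (∣insertAt-inside∣ Y x)) (All.lookup unif (χ⇒∈ {F = F} eq)))) = refl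
    ... | false with does (∣ Y ∣ ≟ s)
    ...   | true  = refl
    ...   | false = refl

  ∣∁∣-section-outside : ∀ {m r} {F : Family (suc m)} → Uniform r F → ∀ x X → section outside x F X ≡ true → ∣ ∁ X ∣ ≡ m ∸ r
  ∣∁∣-section-outside {m} {r} {F} unif x X eq =
    trans (∣∁p∣≡n∸∣p∣ X) (cong (m ∸_) (trans (sym (∣insertAt-outside∣ X x)) (All.lookup unif (χ⇒∈ {F = F} eq))))

  -- Maximum intersecting subfamilies and stars.

  Unique-resp-⊆ : ∀ {n} {F 𝒜 : Family n} → F ⊆ 𝒜 → Unique 𝒜 → Unique F
  Unique-resp-⊆ []         []           = []
  Unique-resp-⊆ (_ ∷ʳ p)   (_ ∷ u)      = Unique-resp-⊆ p u
  Unique-resp-⊆ (refl ∷ p) (X∉𝒜 ∷ u)    = All-resp-⊆ p X∉𝒜 ∷ Unique-resp-⊆ p u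

  weight-mono-⊆ : ∀ {n} (f : Subset n → ℕ) {F 𝒜 : Family n} → F ⊆ 𝒜 → weight f F ≤ weight f 𝒜
  weight-mono-⊆ f []         = z≤n
  weight-mono-⊆ f (X ∷ʳ p)   = ≤-trans (weight-mono-⊆ f p) (m≤n+m _ (f X))
  weight-mono-⊆ f (_∷_ {x = X} refl p) = +-monoʳ-≤ (f X) (weight-mono-⊆ f p)

  subfamilies-⊆ : ∀ {n} (𝒜 : Family n) → All (_⊆ 𝒜) (subfamilies 𝒜)
  subfamilies-⊆ []      = [] ∷ []
  subfamilies-⊆ (X ∷ 𝒜) = All.++⁺ (All.map⁺ (All.map (refl ∷_) (subfamilies-⊆ 𝒜))) (All.map (X ∷ʳ_) (subfamilies-⊆ 𝒜))

  ⊆⇒∈-subfamilies : ∀ {n} {F 𝒜 : Family n} → F ⊆ 𝒜 → F ∈ subfamilies 𝒜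
  ⊆⇒∈-subfamilies []         = here refl
  ⊆⇒∈-subfamilies {𝒜 = X ∷ 𝒜} (_ ∷ʳ p)   = ∈-++⁺ʳ (map (X ∷_) (subfamilies 𝒜)) (⊆⇒∈-subfamilies p)
  ⊆⇒∈-subfamilies {𝒜 = X ∷ 𝒜} (refl ∷ p) = ∈-++⁺ˡ (∈-map⁺ (X ∷_) (⊆⇒∈-subfamilies p))

  ⋆-⊆ : ∀ {n} (𝒜 : Family n) → 𝒜 ⋆ ⊆ 𝒜
  ⋆-⊆ 𝒜 = argmax-all length (minimum 𝒜) (All.filter⁺ intersecting? (subfamilies-⊆ 𝒜))

  ⋆-intersecting : ∀ {n} (𝒜 : Family n) → Intersecting (𝒜 ⋆)
  ⋆-intersecting 𝒜 = argmax-all length [] (All.all-filter intersecting? (subfamilies 𝒜))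

  ⋆-maximum : ∀ {n} {F 𝒜 : Family n} → F ⊆ 𝒜 → Intersecting F → length F ≤ length (𝒜 ⋆)
  ⋆-maximum {F = F} {𝒜} F⊆𝒜 int = All.lookup (f[xs]≤f[argmax] [] (filter intersecting? (subfamilies 𝒜))) (∈-filter⁺ intersecting? (⊆⇒∈-subfamilies F⊆𝒜) int)

  length-⋆ : ∀ {n} (𝒜 : Family n) → length (𝒜 ⋆) + ℓ 𝒜 ≡ length 𝒜
  length-⋆ 𝒜 = m+[n∸m]≡n (length-mono-≤ (⋆-⊆ 𝒜))

  star : ∀ {n} → Fin n → Family n → Family n
  star x = filter (λ X → lookup X x ≟ᵇ inside)

  star-⊆ : ∀ {n} (x : Fin n) 𝒜 → star x 𝒜 ⊆ 𝒜
  star-⊆ x []      = []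
  star-⊆ x (X ∷ 𝒜) with lookup X x
  ... | true  = refl ∷ star-⊆ x 𝒜
  ... | false = X ∷ʳ star-⊆ x 𝒜

  length-star : ∀ {n} (x : Fin n) 𝒜 → length (star x 𝒜) ≡ deg x 𝒜
  length-star x []      = refl
  length-star x (X ∷ 𝒜) with lookup X x
  ... | true  = cong suc (length-star x 𝒜)
  ... | false = length-star x 𝒜

  star-intersecting : ∀ {n} (x : Fin n) 𝒜 → Intersecting (star x 𝒜)
  star-intersecting x 𝒜 = All.map (λ {X} p → All.map (λ {Y} q → x , x∈p∩q⁺ (lookup⇒[]= x X p , lookup⇒[]= x Y q)) all) all
    where all = All.all-filter (λ X → lookup X x ≟ᵇ inside) 𝒜

  -- The star at x competes with `𝒜 ⋆`, and removing it leaves the members that miss x.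
  ℓ≤codeg : ∀ {n} (x : Fin n) 𝒜 → ℓ 𝒜 ≤ codeg x 𝒜
  ℓ≤codeg x 𝒜 = +-cancelˡ-≤ (deg x 𝒜) _ _ (begin
    deg x 𝒜 + ℓ 𝒜          ≤⟨ +-monoˡ-≤ (ℓ 𝒜) (subst (_≤ length (𝒜 ⋆)) (length-star x 𝒜) (⋆-maximum (star-⊆ x 𝒜) (star-intersecting x 𝒜))) ⟩
    length (𝒜 ⋆) + ℓ 𝒜     ≡⟨ length-⋆ 𝒜 ⟩
    length 𝒜               ≡⟨ deg+codeg x 𝒜 ⟨
    deg x 𝒜 + codeg x 𝒜    ∎)
    where open ≤-Reasoning

  codeg≤codeg⋆+ℓ : ∀ {n} (x : Fin n) 𝒜 → codeg x 𝒜 ≤ codeg x (𝒜 ⋆) + ℓ 𝒜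
  codeg≤codeg⋆+ℓ x 𝒜 = +-cancelˡ-≤ (deg x 𝒜) _ _ (begin
    deg x 𝒜 + codeg x 𝒜                   ≡⟨ deg+codeg x 𝒜 ⟩
    length 𝒜                              ≡⟨ length-⋆ 𝒜 ⟨
    length (𝒜 ⋆) + ℓ 𝒜                    ≡⟨ cong (_+ ℓ 𝒜) (deg+codeg x (𝒜 ⋆)) ⟨
    deg x (𝒜 ⋆) + codeg x (𝒜 ⋆) + ℓ 𝒜    ≡⟨ +-assoc (deg x (𝒜 ⋆)) _ _ ⟩
    deg x (𝒜 ⋆) + (codeg x (𝒜 ⋆) + ℓ 𝒜)  ≤⟨ +-monoˡ-≤ _ (weight-mono-⊆ _ (⋆-⊆ 𝒜)) ⟩
    deg x 𝒜 + (codeg x (𝒜 ⋆) + ℓ 𝒜)      ∎)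
    where open ≤-Reasoning

  -- Disjoint pairs across a star.

  dis : ∀ {n} → Subset n → Subset n → Bool
  dis X Y = does (disjoint? X Y)

  Disjoint-sym : ∀ {n} (X Y : Subset n) → Disjoint X Y → Disjoint Y X
  Disjoint-sym X Y d (i , p) = d (i , subst (λ Z → Z Data.Vec.[ i ]= inside) (∩-comm Y X) p)

  dis-sym : ∀ {n} (X Y : Subset n) → dis X Y ≡ true → dis Y X ≡ true
  dis-sym X Y eq = dec-true (disjoint? Y X) (Disjoint-sym X Y (does⇒ (disjoint? X Y) eq))

  hits : ∀ {n} → Fin n → Family n → Subset n → Bool
  hits x []      X = false
  hits x (B ∷ 𝒜) X = (not (lookup B x) ∧ dis B X) ∨ hits x 𝒜 X

  ∈⇒hits : ∀ {n} (x : Fin n) {𝒜 B X} → B ∈ 𝒜 → lookup B x ≡ outside → Disjoint B X → hits x 𝒜 X ≡ true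
  ∈⇒hits x {X = X} (here {B} refl) x∉B d rewrite x∉B | dec-true (disjoint? B X) d = refl
  ∈⇒hits x {B ∷ 𝒜} {X = X} (there B∈𝒜) x∉B d with not (lookup B x) ∧ dis B X
  ... | true  = refl
  ... | false = ∈⇒hits x B∈𝒜 x∉B d

  -- Each counted X is charged to one disjoint pair {X, B} with B missing x; X is the only end of
  -- this pair through x, so no pair is charged twice. In the recursion a head through x is charged
  -- to one of its later neighbours, while a head missing x pays for every later set disjoint from
  -- it.
  star-edges≤e : ∀ {n} (x : Fin n) 𝒜 → weight (λ X → 𝟙 (lookup X x ∧ hits x 𝒜 X)) 𝒜 ≤ e 𝒜
  star-edges≤e x []      = z≤n
  star-edges≤e {n} x (B ∷ 𝒜) with lookup B x
  ... | true  = +-mono-≤ (hits≤degree 𝒜) (star-edges≤e x 𝒜)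
    where
    hits≤degree : ∀ 𝒜 → 𝟙 (hits x 𝒜 B) ≤ length (filter (disjoint? B) 𝒜)
    hits≤degree []      = z≤n
    hits≤degree (D ∷ 𝒜) with dis D B in eq
    ... | true  rewrite dis-sym D B eq = ≤-trans (𝟙-mono {c = true} (λ _ → refl)) (s≤s z≤n)
    ... | false with lookup D x | dis B D
    ...   | true  | true  = m≤n⇒m≤1+n (hits≤degree 𝒜)
    ...   | true  | false = hits≤degree 𝒜
    ...   | false | true  = m≤n⇒m≤1+n (hits≤degree 𝒜)
    ...   | false | false = hits≤degree 𝒜
  ... | false = begin
    weight (λ X → 𝟙 (lookup X x ∧ (dis B X ∨ hits x 𝒜 X))) 𝒜                                   ≤⟨ weight-mono pt 𝒜 ⟩
    weight (λ X → 𝟙 (dis B X) + 𝟙 (lookup X x ∧ hits x 𝒜 X)) 𝒜                                 ≡⟨ weight-+ (λ X → 𝟙 (dis B X)) _ 𝒜 ⟩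
    weight (λ X → 𝟙 (dis B X)) 𝒜 + weight (λ X → 𝟙 (lookup X x ∧ hits x 𝒜 X)) 𝒜              ≤⟨ +-mono-≤ (≤-reflexive (degree 𝒜)) (star-edges≤e x 𝒜) ⟩
    length (filter (disjoint? B) 𝒜) + e 𝒜                                                      ∎
    where
    open ≤-Reasoning
    pt : ∀ X → 𝟙 (lookup X x ∧ (dis B X ∨ hits x 𝒜 X)) ≤ 𝟙 (dis B X) + 𝟙 (lookup X x ∧ hits x 𝒜 X)
    pt X with lookup X x | dis B X
    ... | false | _     = z≤n
    ... | true  | true  = s≤s z≤n
    ... | true  | false = ≤-refl
    degree : ∀ 𝒜 → weight (λ X → 𝟙 (dis B X)) 𝒜 ≡ length (filter (disjoint? B) 𝒜)
    degree []      = refl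
    degree (D ∷ 𝒜) with dis B D
    ... | true  = cong suc (degree 𝒜)
    ... | false = degree 𝒜

  -- Stability and expansion

  sum-coindicator : ∀ {n} (X : Subset n) → ∑ᶠ (λ x → 𝟙 (not (lookup X x))) + ∣ X ∣ ≡ n
  sum-coindicator []            = refl
  sum-coindicator (outside ∷ X) = cong suc (sum-coindicator X)
  sum-coindicator (inside ∷ X)  = trans (+-suc _ ∣ X ∣) (cong suc (sum-coindicator X))

  sum-codeg : ∀ {n r} {F : Family n} → Uniform r F → ∑ᶠ (λ x → codeg x F) + length F * r ≡ length F * n
  sum-codeg {n}     []                   = trans (+-identityʳ _) (sum-replicate-zero n)
  sum-codeg {n} {r} {X ∷ F} (refl ∷ unif) = begin
    ∑ᶠ (λ x → 𝟙 (not (lookup X x)) + codeg x F) + (∣ X ∣ + length F * ∣ X ∣)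
      ≡⟨ cong (_+ (∣ X ∣ + length F * ∣ X ∣)) (∑-distrib-+ (λ x → 𝟙 (not (lookup X x))) _) ⟩
    ∑ᶠ (λ x → 𝟙 (not (lookup X x))) + ∑ᶠ (λ x → codeg x F) + (∣ X ∣ + length F * ∣ X ∣)
      ≡⟨ interchange (∑ᶠ (λ x → 𝟙 (not (lookup X x)))) (∑ᶠ (λ x → codeg x F)) ∣ X ∣ (length F * ∣ X ∣) ⟩
    ∑ᶠ (λ x → 𝟙 (not (lookup X x))) + ∣ X ∣ + (∑ᶠ (λ x → codeg x F) + length F * ∣ X ∣)
      ≡⟨ cong₂ _+_ (sum-coindicator X) (sum-codeg unif) ⟩
    n + length F * n ∎
    where
    open ≡-Reasoning

  ∑ᶠ-mono : ∀ {n} {f g : Fin n → ℕ} → (∀ i → f i ≤ g i) → ∑ᶠ f ≤ ∑ᶠ g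
  ∑ᶠ-mono {zero}  f≤g = z≤n
  ∑ᶠ-mono {suc n} f≤g = +-mono-≤ (f≤g zero) (∑ᶠ-mono (λ i → f≤g (suc i)))

  ∑ᶠ-affine : ∀ {n} a c (f : Fin n → ℕ) → ∑ᶠ (λ i → a + c * f i) ≡ n * a + c * ∑ᶠ f
  ∑ᶠ-affine {zero}  a c f = sym (*-zeroʳ c)
  ∑ᶠ-affine {suc n} a c f = trans (cong (a + c * f zero +_) (∑ᶠ-affine a c (λ i → f (suc i)))) (id₁ a c n (f zero) _)
    where
    id₁ : ∀ a c n x y → a + c * x + (n * a + c * y) ≡ a + n * a + c * (x + y)
    id₁ = solve-∀

  -- At z = k + p = n − 3 the chord ends at C (k + suc p) k, where the bounds for the two layers cross.
  codegree-dichotomy : ∀ {k p b l} → suc p ≤ k →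
    Linear (k + p) k (suc p) b (b + l) → Chord (k + p) k (suc p) b (b + l) →
    let s = suc p ; Q = C (k + suc p) k in
    k * b ≤ s * b + s * l ⊎ k * Q + s * b ≤ s * Q + k * b + k * l
  codegree-dichotomy {suc k'} {p} {b} {l} s≤k lin chord = main
    where
    k = suc k'
    s = suc p
    R = C (k + p) k
    S = C (k + p) s
    sS≡kR : s * S ≡ k * R
    sS≡kR = +-cancelʳ-≡ (p * C (k + p) p) _ _ (begin
      s * S + p * C (k + p) p        ≡⟨ C-sucʳ (k + p) p ⟩
      (k + p) * C (k + p) p          ≡⟨ *-distribʳ-+ (C (k + p) p) k p ⟩
      k * C (k + p) p + p * C (k + p) p ≡⟨ cong (λ e → k * e + p * C (k + p) p) (C-sym k p) ⟨
      k * R + p * C (k + p) p        ∎)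
      where open ≡-Reasoning
    k'-S : C (k + p) k' ≡ S
    k'-S = trans (cong (λ e → C e k') (sym (+-suc k' p))) (trans (C-sym k' (suc p)) (cong (λ e → C e s) (+-suc k' p)))
    Q≡R+S : C (k + s) k ≡ R + S
    Q≡R+S = trans (cong (λ e → C e k) (+-suc k p)) (cong (R +_) k'-S)
    R>0 : 0 < R
    R>0 = C>0 (m≤m+n k p)
    S>0 : 0 < S
    S>0 = C>0 (s≤s (m≤n+m p k'))
    main : k * b ≤ s * b + s * l ⊎ k * C (k + s) k + s * b ≤ s * C (k + s) k + k * b + k * l
    main rewrite Q≡R+S with R ≤? b
    -- On the ray to (R, S) the shadow has at least b S / R = b k / s sets, and at most b + l are
    -- available.
    ... | no R≰b = inj₁ (*-cancelˡ-≤ R {{>-nonZero R>0}} (≤-by _ _ 0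
            (*-monoʳ-≤ s (lin b R (<⇒≤ (≰⇒> R≰b)) (≤-reflexive (*-comm b R))))
            (trans (id₁ R k b s l) (trans (cong (λ e → b * e + s * (R * (b + l))) (sym sS≡kR)) (id₂ R b s S l)))))
      where
      id₁ : ∀ R k b s l → R * (k * b) + s * (R * (b + l)) + 0 ≡ b * (k * R) + s * (R * (b + l))
      id₁ = solve-∀
      id₂ : ∀ R b s S l → b * (s * S) + s * (R * (b + l)) ≡ R * (s * b + s * l) + s * (b * S)
      id₂ = solve-∀
    ... | yes R≤b with m≤n⇒∃[o]m+o≡n R≤b
    ... | w , refl with w ≤? S
    -- On the chord from (R, S) to (R + S, S + R), of slope R / S = s / k, the shadow exceeds b by
    -- at least (k - s)(Q - b) / k, which must not be more than l.
    ...   | yes w≤S = inj₂ (*-cancelˡ-≤ S {{>-nonZero S>0}} (≤-by _ _ 0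
            (*-monoʳ-≤ k (subst (λ e → S * S + w * e ≤ S * (R + w + l)) (sym (C-sym k p)) (chord w S w≤S (≤-reflexive hyp))))
            (trans (id₁ R k w s S l) (trans (cong (λ e → e * w + (S * (k * R) + T)) sS≡kR)
              (trans (cong (λ e → k * R * w + (S * e + T)) (sym sS≡kR)) (id₂ R k w s S l))))))
      where
      hyp : S * R + w * C (k + p) k' ≡ S * (R + w)
      hyp = trans (cong (λ e → S * R + w * e) k'-S) (id₀ S R w)
        where
        id₀ : ∀ S R w → S * R + w * S ≡ S * (R + w)
        id₀ = solve-∀
      T = S * k * R + S * k * S + S * s * R + k * S * w + k * S * l
      id₁ : ∀ R k w s S l → S * (k * (R + S) + s * (R + w)) + k * (S * (R + w + l)) + 0
            ≡ s * S * w + (S * (k * R) + (S * k * R + S * k * S + S * s * R + k * S * w + k * S * l))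
      id₁ = solve-∀
      id₂ : ∀ R k w s S l → k * R * w + (S * (s * S) + (S * k * R + S * k * S + S * s * R + k * S * w + k * S * l))
            ≡ S * (s * (R + S) + k * (R + w) + k * l) + k * (S * S + w * R)
      id₂ = solve-∀
    ...   | no w≰S with m≤n⇒∃[o]m+o≡n (<⇒≤ (≰⇒> w≰S))
    ...     | y , refl = inj₂ (≤-by _ _ (k * l) (*-monoˡ-≤ y s≤k) (id₁ R S k s y l))
      where
      id₁ : ∀ R S k s y l → k * (R + S) + s * (R + (S + y)) + k * y + k * l ≡ s * (R + S) + k * (R + (S + y)) + k * l + s * y
      id₁ = solve-∀

  -- m = n − 1, k = n − 1 − r, s = r − 1.
  section-covers : ∀ {m s} {F : Family (suc m)} → Intersecting F → ∀ x → Covers s (section outside x F) (colink s x F)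
  section-covers {s = s} {F} int x X Y FX ∣Y∣≡s X∥Y rewrite dec-true (∣ Y ∣ ≟ s) ∣Y∣≡s with section inside x F Y in eq
  ... | false = refl
  ... | true  = contradiction (All.lookup (All.lookup int (χ⇒∈ {F = F} FX)) (χ⇒∈ {F = F} eq)) (Disjoint-insertAt x outside inside X Y refl X∥Y)

  -- Both sides count the pairs of a member and a point outside it in a full star on k + s + 2
  -- points: a member misses k + 1 points, and each of the k + s + 1 points other than the centre is
  -- missed by Q members.
  C-codegree : ∀ k s → suc k * C (k + suc s) s ≡ (k + suc s) * C (k + s) k
  C-codegree k s = begin
    suc k * C (k + suc s) s              ≡⟨ cong (λ e → suc k * C e s) (+-suc k s) ⟩
    suc k * C (suc k + s) s              ≡⟨ cong (suc k *_) (C-sym (suc k) s) ⟨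
    suc k * C (suc k + s) (suc k)        ≡⟨ C-absorb (k + s) k ⟩
    suc (k + s) * C (k + s) k            ≡⟨ cong (_* C (k + s) k) (+-suc k s) ⟨
    (k + suc s) * C (k + s) k            ∎
    where open ≡-Reasoning

  stability : ∀ {k p l} {F : Family (suc (k + suc (suc p)))} (let s = suc p ; Q = C (k + s) k) → s ≤ k →
    Unique F → Uniform (suc s) F → Intersecting F → length F + l ≡ C (k + suc s) s →
    s * Q + suc (k + suc s) * (k * l) < k * Q →
    ∃[ x ] k * codeg x F ≤ s * codeg x F + s * l
  stability {k} {p} {l} {F} s≤k uniq unif int size big with any? (λ x → k * codeg x F ≤? suc p * codeg x F + suc p * l)
  ... | yes found = found
  ... | no none   = contradiction big (≤⇒≯ small)
    where
    s = suc p
    Q = C (k + s) k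
    n = suc (k + suc s)
    N = C (k + suc s) s
    f = length F
    second : ∀ x → k * Q + s * codeg x F ≤ (s * Q + k * l) + k * codeg x F
    second x with codegree-dichotomy {b = codeg x F} {l} s≤k
        (subst₂ (Linear (k + p) k s) cb cg (kruskal-katona-linear _ (section outside x F) (colink s x F) s≤k szs (section-covers int x) (k + p) (m≤m+n k p)))
        (subst₂ (Chord (k + p) k s) cb cg (kruskal-katona-chord _ (section outside x F) (colink s x F) s≤k szs (section-covers int x) (k + p) (m≤m+n k p)))
      where
      szs : ∀ X → section outside x F X ≡ true → ∣ ∁ X ∣ ≡ k
      szs X FX = trans (∣∁∣-section-outside unif x X FX) (m+n∸n≡m k (suc s))
      cb : count (section outside x F) ≡ codeg x F
      cb = count-section-outside uniq x
      cg : count (colink s x F) ≡ codeg x F + l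
      cg = +-cancelʳ-≡ (deg x F) _ _ (begin
        count (colink s x F) + deg x F  ≡⟨ count-colink uniq unif x ⟩
        N                               ≡⟨ size ⟨
        f + l                           ≡⟨ cong (_+ l) (deg+codeg x F) ⟨
        deg x F + codeg x F + l         ≡⟨ id₁ (deg x F) (codeg x F) l ⟩
        codeg x F + l + deg x F         ∎)
        where
        open ≡-Reasoning
        id₁ : ∀ a b c → a + b + c ≡ b + c + a
        id₁ = solve-∀
    ... | inj₁ h = contradiction (x , h) none
    ... | inj₂ h = ≤-trans h (≤-reflexive (id₁ (s * Q) (k * codeg x F) (k * l)))
      where
      id₁ : ∀ a b c → a + b + c ≡ a + c + b
      id₁ = solve-∀
    total : ∑ᶠ (λ x → codeg x F) ≡ f * suc k
    total = +-cancelʳ-≡ (f * suc s) _ _ (trans (sum-codeg unif) (id₁ f k s))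
      where
      id₁ : ∀ f k s → f * suc (k + suc s) ≡ f * suc k + f * suc s
      id₁ = solve-∀
    averaged : n * (k * Q) + s * (f * suc k) ≤ n * (s * Q + k * l) + k * (f * suc k)
    averaged = subst (λ e → n * (k * Q) + s * e ≤ n * (s * Q + k * l) + k * e) total
      (subst₂ _≤_ (∑ᶠ-affine (k * Q) s (λ x → codeg x F)) (∑ᶠ-affine (s * Q + k * l) k (λ x → codeg x F)) (∑ᶠ-mono second))
    small : k * Q ≤ s * Q + n * (k * l)
    small with m≤n⇒∃[o]m+o≡n s≤k
    ... | h , s+h≡k = subst (λ k → k * Q ≤ s * Q + n * (k * l)) s+h≡k small' 
      where
      Q-eq : suc k * (f + l) ≡ (k + suc s) * Q
      Q-eq = trans (cong (suc k *_) size) (C-codegree k s)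
      id₁ : ∀ s h Q n f k l → 
        (s + h) * Q + (n * (s * Q + (s + h) * l) + (s + h) * (f * suc k)) + h * (suc k * l)
        ≡ h * (suc k * (f + l)) + (s * Q + s * (f * suc k) + n * (s * Q) + h * Q + n * ((s + h) * l))
      id₁ = solve-∀
      id₂ : ∀ s h Q f k l → 
        h * ((k + suc s) * Q) + (s * Q + s * (f * suc k) + suc (k + suc s) * (s * Q) + h * Q + suc (k + suc s) * ((s + h) * l))
        ≡ s * Q + suc (k + suc s) * ((s + h) * l) + (suc (k + suc s) * ((s + h) * Q) + s * (f * suc k))
      id₂ = solve-∀
      small' : (s + h) * Q ≤ s * Q + n * ((s + h) * l)
      small' = ≤-by _ _ (h * (suc k * l)) (subst (λ c → n * (c * Q) + s * (f * suc k) ≤ n * (s * Q + c * l) + c * (f * suc k)) (sym s+h≡k) averaged)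
        (trans (id₁ s h Q n f k l) (trans (cong (λ e → h * e + (s * Q + s * (f * suc k) + n * (s * Q) + h * Q + n * ((s + h) * l))) Q-eq) (id₂ s h Q f k l)))

  -- The members of 𝒜 missing x have many neighbours among the r-sets containing x, and all but codeg x 𝒜 of these lie in 𝒜.
  expansion : ∀ {k s z} {𝒜 : Family (suc (k + suc s))} → s ≤ k → k ≤ z → Unique 𝒜 → Uniform (suc s) 𝒜 →
    length 𝒜 ≡ C (k + suc s) s → ∀ x → codeg x 𝒜 ≤ C z k →
    codeg x 𝒜 * C z s ≤ C z k * (e 𝒜 + codeg x 𝒜)
  expansion {k} {s} {z} {𝒜} s≤k k≤z uniq unif size x t≤C = begin
    t * C z s              ≤⟨ subst (λ t → t * C z s ≤ C z k * count G) (count-section-outside uniq x)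
                                (kruskal-katona-linear _ (section outside x 𝒜) G s≤k szs cov z k≤z _ (C z k)
                                  (subst (_≤ C z k) (sym (count-section-outside uniq x)) t≤C) (≤-reflexive (*-comm (count (section outside x 𝒜)) _))) ⟩
    C z k * count G        ≤⟨ *-monoʳ-≤ (C z k) G≤ ⟩
    C z k * (e 𝒜 + t)      ∎
    where
    open ≤-Reasoning
    m = k + suc s
    t = codeg x 𝒜
    G : Subset m → Bool
    G Y = does (∣ Y ∣ ≟ s) ∧ hits x 𝒜 (insertAt Y x inside)
    szs : ∀ X → section outside x 𝒜 X ≡ true → ∣ ∁ X ∣ ≡ k
    szs X FX = trans (∣∁∣-section-outside unif x X FX) (m+n∸n≡m k (suc s))
    cov : Covers s (section outside x 𝒜) G
    cov X Y FX ∣Y∣≡s X∥Y rewrite dec-true (∣ Y ∣ ≟ s) ∣Y∣≡s =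
      ∈⇒hits x (χ⇒∈ {F = 𝒜} FX) (insertAt-lookup X x outside) (Disjoint-insertAt x outside inside X Y refl X∥Y)
    w : Subset (suc m) → ℕ
    w X = 𝟙 (χ 𝒜 X) * 𝟙 (lookup X x ∧ hits x 𝒜 X)
    -- The size of 𝒜 enters here: 𝒜 is as large as a full star, so it lacks as many sets through x
    -- as it has sets missing x.
    colink≡t : count (colink s x 𝒜) ≡ t
    colink≡t = +-cancelʳ-≡ (deg x 𝒜) _ _ (trans (count-colink uniq unif x) (trans (sym size) (trans (sym (deg+codeg x 𝒜)) (+-comm (deg x 𝒜) t))))
    pt : ∀ Y → 𝟙 (G Y) ≤ w (insertAt Y x inside) + 𝟙 (colink s x 𝒜 Y)
    pt Y rewrite insertAt-lookup Y x inside with does (∣ Y ∣ ≟ s) | hits x 𝒜 (insertAt Y x inside) | section inside x 𝒜 Y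
    ... | false | _     | _     = z≤n
    ... | true  | false | _     = z≤n
    ... | true  | true  | true  = ≤-refl
    ... | true  | true  | false = ≤-refl
    G≤ : count G ≤ e 𝒜 + t
    G≤ = begin
      count G                                                                    ≤⟨ ∑-mono pt ⟩
      ∑ (λ Y → w (insertAt Y x inside) + 𝟙 (colink s x 𝒜 Y))                     ≡⟨ ∑-+ (λ Y → w (insertAt Y x inside)) _ ⟩
      ∑ (λ Y → w (insertAt Y x inside)) + count (colink s x 𝒜)                   ≤⟨ +-mono-≤ (m≤n+m _ (∑ (λ Y → w (insertAt Y x outside)))) (≤-reflexive colink≡t) ⟩
      ∑ (λ Y → w (insertAt Y x outside)) + ∑ (λ Y → w (insertAt Y x inside)) + t  ≡⟨ cong (_+ t) (∑-insertAt x w) ⟨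
      ∑ w + t                                                                    ≡⟨ cong (_+ t) (weight-χ uniq _) ⟩
      weight (λ X → 𝟙 (lookup X x ∧ hits x 𝒜 X)) 𝒜 + t                          ≤⟨ +-monoˡ-≤ t (star-edges≤e x 𝒜) ⟩
      e 𝒜 + t                                                                    ∎

  -- Estimates

  C≤2^ : ∀ n k → C n k ≤ 2 ^ n
  C≤2^ n       zero    = m^n>0 2 n
  C≤2^ zero    (suc k) = z≤n
  C≤2^ (suc n) (suc k) = +-mono-≤ (C≤2^ n (suc k)) (≤-trans (C≤2^ n k) (≤-reflexive (sym (+-identityʳ (2 ^ n)))))

  -- Iterates C(n, s) = (n / s) C(n - 1, s - 1), in which every factor is at least 2.
  2^≤C : ∀ {n} s → 2 * s ≤ n → 2 ^ s ≤ C n s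
  2^≤C         zero    _   = ≤-refl
  2^≤C {suc n} (suc s) 2s≤n = *-cancelˡ-≤ (suc s) (begin
    suc s * (2 * 2 ^ s)    ≡⟨ id₁ (suc s) (2 ^ s) ⟩
    2 * suc s * 2 ^ s      ≤⟨ *-mono-≤ 2s≤n (2^≤C s (≤-pred (≤-trans (n≤1+n _) (≤-trans (≤-reflexive (id₂ s)) 2s≤n)))) ⟩
    suc n * C n s          ≡⟨ C-absorb n s ⟨
    suc s * C (suc n) (suc s) ∎)
    where
    open ≤-Reasoning
    id₁ : ∀ s x → s * (2 * x) ≡ 2 * s * x
    id₁ = solve-∀
    id₂ : ∀ s → suc (suc (2 * s)) ≡ 2 * suc s
    id₂ = solve-∀

  C-lower : ∀ a k → suc (a + k) * C (a + k) k ≡ suc a * C (suc (a + k)) k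
  C-lower a k = +-cancelʳ-≡ (k * C (suc (a + k)) k) _ _ (trans (C-sucˡ (a + k) k) (id₁ a k (C (suc (a + k)) k)))
    where
    id₁ : ∀ a k c → suc (a + k) * c ≡ suc a * c + k * c
    id₁ = solve-∀

  -- Lowering the upper index from a + 1 + k to a + k costs the factor (a + 1 + k) / (a + 1), and a
  -- ≥ i keeps it at most D.
  C-shrink : ∀ k i j D → j + i + k ≤ D * suc i → C (j + i + k) k ≤ D ^ j * C (i + k) k
  C-shrink k i zero    D h = ≤-reflexive (sym (*-identityˡ _))
  C-shrink k i (suc j) D h = *-cancelˡ-≤ (suc (j + i)) (begin
    suc (j + i) * C (suc (j + i + k)) k      ≡⟨ C-lower (j + i) k ⟨
    suc (j + i + k) * C (j + i + k) k        ≤⟨ *-mono-≤ h (C-shrink k i j D (≤-trans (n≤1+n _) h)) ⟩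
    D * suc i * (D ^ j * C (i + k) k)        ≤⟨ *-monoˡ-≤ _ (*-monoʳ-≤ D (s≤s (m≤n+m i j))) ⟩
    D * suc (j + i) * (D ^ j * C (i + k) k)  ≡⟨ id₂ D (suc (j + i)) (D ^ j) (C (i + k) k) ⟩
    suc (j + i) * (D * D ^ j * C (i + k) k)  ∎)
    where
    open ≤-Reasoning
    id₂ : ∀ D x y c → D * x * (y * c) ≡ x * (D * y * c)
    id₂ = solve-∀

  -- At z = k + s − j the ratio of the two binomials has grown from 1 by at least 1 + 1/E per step.
  C-gain : ∀ E j a b {k s z} → k ≡ b + j → s ≡ a + j → z ≡ a + b + j → suc E * s ≤ E * k →
           suc E ^ j * C z k ≤ E ^ j * C z s
  C-gain E zero a b {k} {s} {z} refl refl refl h = +-monoˡ-≤ 0 (≤-reflexive (subst (λ z → C z k ≡ C z s) (id₁ a b) (C-sym k s)))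
    where
    id₁ : ∀ a b → b + 0 + (a + 0) ≡ a + b + 0
    id₁ = solve-∀
  C-gain E (suc j) a b {k} {s} {z} refl refl z≡ h = *-cancelˡ-≤ (suc z) (begin
    suc z * (suc E * suc E ^ j * C z k)        ≡⟨ id₁ (suc z) (suc E) (suc E ^ j) (C z k) ⟩
    suc E * (suc E ^ j * (suc z * C z k))      ≡⟨ cong (λ e → suc E * (suc E ^ j * e)) (subst (λ z → suc z * C z k ≡ suc a * C (suc z) k) (sym (trans z≡ (+-assoc a b (suc j)))) (C-lower a k)) ⟩
    suc E * (suc E ^ j * (suc a * C (suc z) k)) ≡⟨ id₂ (suc E) (suc a) (suc E ^ j) (C (suc z) k) ⟩
    suc E * suc a * (suc E ^ j * C (suc z) k)  ≤⟨ *-mono-≤ ratio (C-gain E j (suc a) (suc b) (+-suc b j) (+-suc a j) (trans (cong suc z≡) (id₃ a b j)) h) ⟩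
    E * suc b * (E ^ j * C (suc z) s)          ≡⟨ id₂ E (suc b) (E ^ j) (C (suc z) s) ⟨
    E * (E ^ j * (suc b * C (suc z) s))        ≡⟨ cong (λ e → E * (E ^ j * e)) (subst (λ z → suc z * C z s ≡ suc b * C (suc z) s) (sym (trans z≡ (id₄ a b j))) (C-lower b s)) ⟨
    E * (E ^ j * (suc z * C z s))              ≡⟨ id₁ (suc z) E (E ^ j) (C z s) ⟨
    suc z * (E * E ^ j * C z s)                ∎)
    where
    open ≤-Reasoning
    id₁ : ∀ z e p c → z * (e * p * c) ≡ e * (p * (z * c))
    id₁ = solve-∀
    id₂ : ∀ e a p c → e * (p * (a * c)) ≡ e * a * (p * c)
    id₂ = solve-∀
    id₃ : ∀ a b j → suc (a + b + suc j) ≡ suc a + suc b + j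
    id₃ = solve-∀
    id₄ : ∀ a b j → a + b + suc j ≡ b + (a + suc j)
    id₄ = solve-∀
    -- The factor of one step is (k - j) / (s - j) with the current j; subtracting j from both only
    -- increases the ratio k / s ≥ 1 + 1/E.
    ratio : suc E * suc a ≤ E * suc b
    ratio = ≤-by _ _ j h (id₅ E a b j)
      where
      id₅ : ∀ E a b j → suc E * suc a + E * (b + suc j) + j ≡ E * suc b + suc E * (a + suc j)
      id₅ = solve-∀

  -- (1 + 1/E)^m ≥ 1 + m/E with denominators cleared; at m = E it yields the factor 2.
  bernoulli : ∀ E m → E ^ m * (E + m) ≤ E * suc E ^ m
  bernoulli E zero    = ≤-reflexive (id₁ E)
    where
    id₁ : ∀ E → 1 * (E + 0) ≡ E * 1
    id₁ = solve-∀
  bernoulli E (suc m) = ≤-by _ _ (m * E ^ m) (*-monoʳ-≤ (suc E) (bernoulli E m)) (id₁ E m (E ^ m) (suc E ^ m))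
    where
    id₁ : ∀ E m p q → E * p * (E + suc m) + suc E * (E * q) + m * p ≡ E * (suc E * q) + suc E * (p * (E + m))
    id₁ = solve-∀

  2E^E≤ : ∀ E .{{_ : NonZero E}} → 2 * E ^ E ≤ suc E ^ E
  2E^E≤ E = *-cancelˡ-≤ E (≤-trans (≤-reflexive (id₁ E (E ^ E))) (bernoulli E E))
    where
    id₁ : ∀ E p → E * (2 * p) ≡ p * (E + E)
    id₁ = solve-∀

  ^-distribʳ-* : ∀ q a b → (a * b) ^ q ≡ a ^ q * b ^ q
  ^-distribʳ-* zero    a b = refl
  ^-distribʳ-* (suc q) a b = trans (cong (a * b *_) (^-distribʳ-* q a b)) (id₁ a b (a ^ q) (b ^ q))
    where
    id₁ : ∀ a b x y → a * b * (x * y) ≡ a * x * (b * y)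
    id₁ = solve-∀

  ^-cancelˡ-< : ∀ q {a b} → a ^ q < b ^ q → a < b
  ^-cancelˡ-< q {a} {b} h with a <? b
  ... | yes p = p
  ... | no ¬p = contradiction h (≤⇒≯ (^-monoˡ-≤ q (≮⇒≥ ¬p)))

  n≤2^n : ∀ n → n ≤ 2 ^ n
  n≤2^n zero    = z≤n
  n≤2^n (suc n) = subst (suc n ≤_) (cong (2 ^ n +_) (sym (+-identityʳ _))) (+-mono-≤ (m^n>0 2 n) (n≤2^n n))

  -- With H = h + 1 the hypotheses read 2 X < N^(1/H) and l ≤ 2 N^(1 - 1/H).
  gap-power : ∀ {X l N h} → (2 * X) ^ suc h < N → l ^ suc h ≤ 2 ^ suc h * N ^ h → X * l < N
  gap-power {X} {l} {N} {h} big small = ^-cancelˡ-< (suc h) (begin-strict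
    (X * l) ^ suc h                       ≡⟨ ^-distribʳ-* (suc h) X l ⟩
    X ^ suc h * l ^ suc h                 ≤⟨ *-monoʳ-≤ (X ^ suc h) small ⟩
    X ^ suc h * (2 ^ suc h * N ^ h)       ≡⟨ id₁ (X ^ suc h) (2 ^ suc h) (N ^ h) ⟩
    2 ^ suc h * X ^ suc h * N ^ h         ≡⟨ cong (_* N ^ h) (^-distribʳ-* (suc h) 2 X) ⟨
    (2 * X) ^ suc h * N ^ h               <⟨ *-monoˡ-< (N ^ h) {{m^n≢0 N h {{>-nonZero (≤-<-trans z≤n big)}}}} big ⟩
    N * N ^ h                             ∎)
    where
    open ≤-Reasoning
    id₁ : ∀ x y z → x * (y * z) ≡ y * x * z
    id₁ = solve-∀

  -- The hypothesis bounds e below by t (p / r - 1), which increases with t because r ≤ p. This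
  -- passes from the number t of exceptional sets to ℓ ≤ t.
  shrink-excess : ∀ {l t p r e} → l ≤ t → r ≤ p → t * p ≤ r * (e + t) → l * p ≤ r * (e + l)
  shrink-excess {l} {t} {p} {r} {e} l≤t r≤p h with m≤n⇒∃[o]m+o≡n l≤t
  ... | y , refl = ≤-by _ _ 0 (+-mono-≤ h (*-monoʳ-≤ y r≤p)) (id₁ l y p r e)
    where
    id₁ : ∀ l y p r e → l * p + (r * (e + (l + y)) + y * p) + 0 ≡ r * (e + l) + ((l + y) * p + y * r)
    id₁ = solve-∀

  -- With r ≥ W j and n < 2 J j, the factor C(n-1,r-1) ≥ 2^(r-1) dominates every 2^(O(j)) loss in the argument,
  -- and q is so large that (1 + 1/E)^(j q) ≥ 2^n.
  module Constants (E h : ℕ) (1≤E : 1 ≤ E) where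

    H W J c q′ q : ℕ
    H = suc h
    -- The H-th power of 2 X ≤ 2^((1 + 2 E) j) has to stay below 2^s ≤ N. The last summand 2
    -- accounts for r = s + 1 and gives j ≤ r / 2.
    W = H + 2 * E * H + 2
    J = E * W
    -- Absorbs 2 (E + 1), from t ≤ (E + 1) l, and 2 E J, from k ≤ n ≤ 2 J j.
    c = 4 * E * J * suc E
    -- Also makes n > q force j ≥ 2 c.
    q′ = 4 * J * c
    q = E * q′

    1≤W : 1 ≤ W
    1≤W = ≤-trans (s≤s z≤n) (m≤n+m 2 (H + 2 * E * H))

    1≤J : 1 ≤ J
    1≤J = *-mono-≤ 1≤E 1≤W

    1≤c : 1 ≤ c
    1≤c = *-mono-≤ {1} {4 * E * J} {1} (*-mono-≤ {1} {4 * E} {1} (*-mono-≤ {1} {4} (s≤s z≤n) 1≤E) 1≤J) (s≤s z≤n)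

    1≤q : 1 ≤ q
    1≤q = *-mono-≤ {1} {E} {1} 1≤E (*-mono-≤ {1} {4 * J} {1} (*-mono-≤ {1} {4} (s≤s z≤n) 1≤J) 1≤c)

    instance
      E≢0 : NonZero E
      E≢0 = >-nonZero 1≤E
      J≢0 : NonZero J
      J≢0 = >-nonZero 1≤J

    module Large {j k p : ℕ}
      (2c≤j : 2 * c ≤ j) (n≤2Jj : suc (k + suc (suc p)) ≤ 2 * J * j) (Wj≤r : W * j ≤ suc (suc p))
      (s≤k : suc p ≤ k) (n≤Er : suc (k + suc (suc p)) ≤ E * suc (suc p))
      (gap : 2 * suc (k + suc (suc p)) + E * suc p ≤ E * k)
      (𝒜 : Family (suc (k + suc (suc p)))) (uniq : Unique 𝒜) (unif : Uniform (suc (suc p)) 𝒜)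
      (size : length 𝒜 ≡ C (k + suc (suc p)) (suc p))
      (ℓ-small : ℓ 𝒜 ^ H ≤ 2 ^ H * C (k + suc (suc p)) (suc p) ^ h) where

      open ≤-Reasoning

      n s N Q X l : ℕ
      s = suc p
      n = suc (k + suc s)
      N = C (k + suc s) s
      Q = C (k + s) k
      X = c * (2 * E) ^ j
      l = ℓ 𝒜

      1≤j : 1 ≤ j
      1≤j = ≤-trans (*-mono-≤ {1} {2} (s≤s z≤n) 1≤c) 2c≤j

      exponent<s : (j + 2 * E * j) * H < s
      exponent<s = ≤-pred (≤-trans (≤-by _ _ 0 (*-monoʳ-≤ 2 1≤j) (id₁ j E h)) Wj≤r)
        where
        id₁ : ∀ j E h → suc (suc ((j + 2 * E * j) * suc h)) + 2 * j + 0 ≡ (suc h + 2 * E * suc h + 2) * j + 2 * 1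
        id₁ = solve-∀

      2X≤ : 2 * X ≤ 2 ^ (j + 2 * E * j)
      2X≤ = begin
        2 * (c * (2 * E) ^ j)         ≡⟨ *-assoc 2 c _ ⟨
        2 * c * (2 * E) ^ j           ≤⟨ *-mono-≤ (≤-trans 2c≤j (n≤2^n j)) (^-monoˡ-≤ j (n≤2^n (2 * E))) ⟩
        2 ^ j * (2 ^ (2 * E)) ^ j     ≡⟨ cong (2 ^ j *_) (^-*-assoc 2 (2 * E) j) ⟩
        2 ^ j * 2 ^ (2 * E * j)       ≡⟨ ^-distribˡ-+-* 2 j (2 * E * j) ⟨
        2 ^ (j + 2 * E * j)           ∎

      big : (2 * X) ^ H < N
      big = begin-strict
        (2 * X) ^ H                   ≤⟨ ^-monoˡ-≤ H 2X≤ ⟩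
        (2 ^ (j + 2 * E * j)) ^ H     ≡⟨ ^-*-assoc 2 (j + 2 * E * j) H ⟩
        2 ^ ((j + 2 * E * j) * H)     <⟨ ^-monoʳ-< 2 (s≤s (s≤s z≤n)) exponent<s ⟩
        2 ^ s                         ≤⟨ 2^≤C s (≤-by _ _ 1 s≤k (id₁ s k)) ⟩
        N                             ∎
        where
        id₁ : ∀ s k → 2 * s + k + 1 ≡ k + suc s + s
        id₁ = solve-∀

      Xl<N : X * l < N
      Xl<N = gap-power {X} {l} {N} {h} big ℓ-small

      N≤2Q : N ≤ 2 * Q
      N≤2Q = *-cancelˡ-≤ (suc k) (begin
        suc k * N             ≡⟨ C-codegree k s ⟩
        (k + suc s) * Q       ≤⟨ *-monoˡ-≤ Q (≤-by (k + suc s) (2 * suc k) 1 s≤k (id₁ k s)) ⟩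
        2 * suc k * Q         ≡⟨ id₂ (suc k) Q ⟩
        suc k * (2 * Q)       ∎)
        where
        id₁ : ∀ k s → k + suc s + k + 1 ≡ 2 * suc k + s
        id₁ = solve-∀
        id₂ : ∀ k Q → 2 * k * Q ≡ k * (2 * Q)
        id₂ = solve-∀

      j≤[2E]^j : j ≤ (2 * E) ^ j
      j≤[2E]^j = ≤-trans (n≤2^n j) (^-monoˡ-≤ j (*-mono-≤ {2} {2} {1} ≤-refl 1≤E))

      Ek≤X : E * k ≤ X
      Ek≤X = begin
        E * k                                  ≤⟨ *-monoʳ-≤ E (≤-trans (m≤n⇒m≤1+n (m≤m+n k (suc s))) n≤2Jj) ⟩
        E * (2 * J * j)                        ≤⟨ ≤-by _ _ 0 (z≤n {(2 * E * J + 4 * E * E * J) * j}) (id₁ E J j) ⟩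
        c * j                                  ≤⟨ *-monoʳ-≤ c j≤[2E]^j ⟩
        X                                      ∎
        where
        id₁ : ∀ E J j → E * (2 * J * j) + (2 * E * J + 4 * E * E * J) * j + 0 ≡ 4 * E * J * suc E * j + 0
        id₁ = solve-∀

      Ekl<2Q : E * k * l < 2 * Q
      Ekl<2Q = <-≤-trans (≤-<-trans (*-monoˡ-≤ l Ek≤X) Xl<N) N≤2Q

      -- E k l ≤ X l < N ≤ 2 Q, whereas `gap` gives E (k - s) ≥ 2 n.
      stability-hypothesis : s * Q + n * (k * l) < k * Q
      stability-hypothesis = *-cancelˡ-< E _ _ (begin-strict
        E * (s * Q + n * (k * l))         ≡⟨ id₁ E s Q n k l ⟩
        E * s * Q + n * (E * k * l)       <⟨ +-monoʳ-< (E * s * Q) (*-monoʳ-< n Ekl<2Q) ⟩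
        E * s * Q + n * (2 * Q)           ≡⟨ id₂ (E * s) Q n ⟩
        (2 * n + E * s) * Q               ≤⟨ *-monoˡ-≤ Q gap ⟩
        E * k * Q                         ≡⟨ *-assoc E k Q ⟩
        E * (k * Q)                       ∎)
        where
        id₁ : ∀ E s Q n k l → E * (s * Q + n * (k * l)) ≡ E * s * Q + n * (E * k * l)
        id₁ = solve-∀
        id₂ : ∀ a Q n → a * Q + n * (2 * Q) ≡ (2 * n + a) * Q
        id₂ = solve-∀

      centre : ∃[ x ] k * codeg x (𝒜 ⋆) ≤ s * codeg x (𝒜 ⋆) + s * l
      centre = stability s≤k (Unique-resp-⊆ (⋆-⊆ 𝒜) uniq) (All-resp-⊆ (⋆-⊆ 𝒜) unif) (⋆-intersecting 𝒜)
        (trans (length-⋆ 𝒜) size) stability-hypothesis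

      x : Fin n
      x = proj₁ centre

      t b : ℕ
      t = codeg x 𝒜
      b = codeg x (𝒜 ⋆)

      -- (k - s) b ≤ s l and E (k - s) ≥ 2 n give 2 n b ≤ E s l, and s ≤ n.
      b≤El : b ≤ E * l
      b≤El = *-cancelˡ-≤ n (≤-by _ _ (n * b + E * (k + 2) * l)
        (+-mono-≤ (*-monoˡ-≤ b gap) (*-monoʳ-≤ E (proj₂ centre))) (id₁ k s E b l))
        where
        id₁ : ∀ k s E b l →
          suc (k + suc s) * b + (E * k * b + E * (s * b + s * l)) + (suc (k + suc s) * b + E * (k + 2) * l)
          ≡ suc (k + suc s) * (E * l) + ((2 * suc (k + suc s) + E * s) * b + E * (k * b))
        id₁ = solve-∀

      t≤ : t ≤ suc E * l
      t≤ = begin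
        t               ≤⟨ codeg≤codeg⋆+ℓ x 𝒜 ⟩
        b + l           ≤⟨ +-monoˡ-≤ l b≤El ⟩
        E * l + l       ≡⟨ +-comm (E * l) l ⟩
        suc E * l       ∎

      2j≤r : 2 * j ≤ suc s
      2j≤r = ≤-trans (*-monoˡ-≤ j (m≤n+m 2 (H + 2 * E * H))) Wj≤r

      j≤s : j ≤ s
      j≤s = ≤-pred (≤-trans (≤-by (suc j) (2 * j) 0 1≤j (id₁ j)) 2j≤r)
        where
        id₁ : ∀ j → suc j + j + 0 ≡ 2 * j + 1
        id₁ = solve-∀

      -- z = k + s - j lies j steps below the point where both layers have size Q. Each step gains a
      -- factor 1 + 1/E in the ratio of the layers and divides `C z k` by at most 2 E; `C z k` must
      -- stay above t.
      i z b′ : ℕ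
      i = s ∸ j
      z = i + k
      b′ = k ∸ j

      j+i≡s : j + i ≡ s
      j+i≡s = m+[n∸m]≡n j≤s

      shrink : Q ≤ (2 * E) ^ j * C z k
      shrink = subst (λ e → C e k ≤ (2 * E) ^ j * C z k) (trans (cong (_+ k) j+i≡s) (+-comm s k))
        (C-shrink k i j (2 * E) (begin
          j + i + k         ≡⟨ cong (_+ k) j+i≡s ⟩
          s + k             ≤⟨ ≤-by (s + k) n 2 (≤-refl {0}) (id₁ s k) ⟩
          n                 ≤⟨ n≤Er ⟩
          E * suc s         ≤⟨ *-monoʳ-≤ E (≤-by (suc s) (2 * suc i) 0 2j≤r (trans (cong (λ s → suc s + suc s + 0) (sym j+i≡s)) (id₂ i j))) ⟩
          E * (2 * suc i)   ≡⟨ id₃ E (suc i) ⟩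
          2 * E * suc i     ∎))
        where
        id₁ : ∀ s k → s + k + 0 + 2 ≡ suc (k + suc s) + 0
        id₁ = solve-∀
        id₂ : ∀ i j → suc (j + i) + suc (j + i) + 0 ≡ 2 * suc i + 2 * j
        id₂ = solve-∀
        id₃ : ∀ E i → E * (2 * i) ≡ 2 * E * i
        id₃ = solve-∀

      t≤C : t ≤ C z k
      t≤C = <⇒≤ (*-cancelˡ-< (2 * (2 * E) ^ j) _ _ (begin-strict
        2 * (2 * E) ^ j * t                  ≤⟨ *-monoʳ-≤ (2 * (2 * E) ^ j) t≤ ⟩
        2 * (2 * E) ^ j * (suc E * l)        ≡⟨ id₁ ((2 * E) ^ j) E l ⟩
        2 * suc E * ((2 * E) ^ j * l)        ≤⟨ *-monoˡ-≤ ((2 * E) ^ j * l) 2K≤c ⟩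
        c * ((2 * E) ^ j * l)                ≡⟨ *-assoc c _ l ⟨
        X * l                                <⟨ Xl<N ⟩
        N                                    ≤⟨ N≤2Q ⟩
        2 * Q                                ≤⟨ *-monoʳ-≤ 2 shrink ⟩
        2 * ((2 * E) ^ j * C z k)            ≡⟨ *-assoc 2 ((2 * E) ^ j) (C z k) ⟨
        2 * (2 * E) ^ j * C z k              ∎))
        where
        id₁ : ∀ p E l → 2 * p * (suc E * l) ≡ 2 * suc E * (p * l)
        id₁ = solve-∀
        2K≤c : 2 * suc E ≤ c
        2K≤c = *-monoˡ-≤ (suc E) (*-mono-≤ {2} {4 * E} {1} (*-mono-≤ {2} {4} {1} (s≤s (s≤s z≤n)) 1≤E) 1≤J)

      expanded : t * suc E ^ j ≤ E ^ j * (e 𝒜 + t)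
      expanded = *-cancelˡ-≤ (C z k) {{>-nonZero (C>0 (m≤n+m k i))}} (begin
        C z k * (t * suc E ^ j)         ≡⟨ id₀ (C z k) t (suc E ^ j) ⟩
        t * (suc E ^ j * C z k)         ≤⟨ *-monoʳ-≤ t (C-gain E j i b′ (sym (m∸n+n≡m (≤-trans j≤s s≤k))) (sym (m∸n+n≡m j≤s))
                                             (sym (trans (+-assoc i b′ j) (cong (i +_) (m∸n+n≡m (≤-trans j≤s s≤k))))) ratio) ⟩
        t * (E ^ j * C z s)             ≡⟨ id₁ t (E ^ j) (C z s) ⟩
        E ^ j * (t * C z s)             ≤⟨ *-monoʳ-≤ (E ^ j) (expansion s≤k (m≤n+m k i) uniq unif size x t≤C) ⟩
        E ^ j * (C z k * (e 𝒜 + t))     ≡⟨ id₁ (E ^ j) (C z k) _ ⟩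
        C z k * (E ^ j * (e 𝒜 + t))     ∎)
        where
        id₀ : ∀ a b c → a * (b * c) ≡ b * (c * a)
        id₀ = solve-∀
        id₁ : ∀ a b c → a * (b * c) ≡ b * (a * c)
        id₁ = solve-∀
        ratio : suc E * s ≤ E * k
        ratio = ≤-trans (+-monoˡ-≤ (E * s) (≤-by s (2 * n) 0 (z≤n {k + k + s + 4}) (id₂ k s))) gap
          where
          id₂ : ∀ k s → s + (k + k + s + 4) + 0 ≡ 2 * suc (k + suc s) + 0
          id₂ = solve-∀

      l-expanded : l * suc E ^ j ≤ E ^ j * (e 𝒜 + l)
      l-expanded = shrink-excess (ℓ≤codeg x 𝒜) (^-monoˡ-≤ j (n≤1+n E)) expanded

      l≤2^n : l ≤ 2 ^ n
      l≤2^n = ≤-trans (≤-trans (m≤n+m l (length (𝒜 ⋆))) (≤-reflexive (trans (length-⋆ 𝒜) size)))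
        (≤-trans (C≤2^ (k + suc s) s) (^-monoʳ-≤ 2 (n≤1+n (k + suc s))))

      n≤jq′ : n ≤ j * q′
      n≤jq′ = begin
        n                     ≤⟨ n≤2Jj ⟩
        2 * J * j             ≤⟨ *-monoˡ-≤ j (*-monoˡ-≤ J {2} {4} (s≤s (s≤s z≤n))) ⟩
        4 * J * j             ≡⟨ id₁ J j ⟩
        j * (4 * J * 1)       ≤⟨ *-monoʳ-≤ j (*-monoʳ-≤ (4 * J) 1≤c) ⟩
        j * q′                ∎
        where
        id₁ : ∀ J j → 4 * J * j ≡ j * (4 * J * 1)
        id₁ = solve-∀

      -- Since (1 + 1/E)^E ≥ 2 and q = E q′, the q-th power of the expansion factor is at least 2^(j
      -- q′) ≥ 2^n ≥ ℓ. It supplies the extra factor ℓ in `bound`.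
      power : l * (E ^ j) ^ q ≤ (suc E ^ j) ^ q
      power = begin
        l * (E ^ j) ^ q                    ≤⟨ *-monoˡ-≤ _ (≤-trans l≤2^n (^-monoʳ-≤ 2 n≤jq′)) ⟩
        2 ^ (j * q′) * (E ^ j) ^ q         ≡⟨ cong (2 ^ (j * q′) *_) (swap-exp E) ⟩
        2 ^ (j * q′) * (E ^ E) ^ (j * q′)  ≡⟨ ^-distribʳ-* (j * q′) 2 (E ^ E) ⟨
        (2 * E ^ E) ^ (j * q′)             ≤⟨ ^-monoˡ-≤ (j * q′) (2E^E≤ E) ⟩
        (suc E ^ E) ^ (j * q′)             ≡⟨ swap-exp (suc E) ⟨
        (suc E ^ j) ^ q                    ∎
        where
        swap-exp : ∀ a → (a ^ j) ^ q ≡ (a ^ E) ^ (j * q′)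
        swap-exp a = trans (^-*-assoc a j q) (trans (cong (a ^_) (id₁ j E q′)) (sym (^-*-assoc a E (j * q′))))
          where
          id₁ : ∀ j E q′ → j * (E * q′) ≡ E * (j * q′)
          id₁ = solve-∀

      bound : l ^ suc q ≤ (e 𝒜 + 2 * l) ^ q
      bound = *-cancelˡ-≤ ((E ^ j) ^ q) {{m^n≢0 (E ^ j) q {{m^n≢0 E j}}}} (begin
        (E ^ j) ^ q * (l * l ^ q)           ≡⟨ id₁ ((E ^ j) ^ q) l (l ^ q) ⟩
        l ^ q * (l * (E ^ j) ^ q)           ≤⟨ *-monoʳ-≤ (l ^ q) power ⟩
        l ^ q * (suc E ^ j) ^ q             ≡⟨ ^-distribʳ-* q l (suc E ^ j) ⟨
        (l * suc E ^ j) ^ q                 ≤⟨ ^-monoˡ-≤ q (≤-trans l-expanded (*-monoʳ-≤ (E ^ j) (+-monoʳ-≤ (e 𝒜) (m≤m+n l (l + 0))))) ⟩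
        (E ^ j * (e 𝒜 + 2 * l)) ^ q         ≡⟨ ^-distribʳ-* q (E ^ j) _ ⟩
        (E ^ j) ^ q * (e 𝒜 + 2 * l) ^ q     ∎)
        where
        id₁ : ∀ a b c → a * (b * c) ≡ c * (b * a)
        id₁ = solve-∀

  module _ (E h : ℕ) (1≤E : 1 ≤ E) where
    open Constants E h 1≤E

    small-ℓ-bound : ∀ {l} e → l ≤ 2 ^ q → l ^ suc q ≤ (e + 2 * l) ^ q
    small-ℓ-bound {l} e l≤2^q = begin
      l * l ^ q            ≤⟨ *-monoˡ-≤ (l ^ q) l≤2^q ⟩
      2 ^ q * l ^ q        ≡⟨ ^-distribʳ-* q 2 l ⟨
      (2 * l) ^ q          ≤⟨ ^-monoˡ-≤ q (m≤n+m (2 * l) e) ⟩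
      (e + 2 * l) ^ q      ∎
      where open ≤-Reasoning

    large-n-bound : ∀ {n r} (𝒜 : Family n) → q < n →
      n ≤ E * r → 2 * E * r + 2 * n ≤ n * E →
      Unique 𝒜 → Uniform r 𝒜 → length 𝒜 ≡ C (n ∸ 1) (r ∸ 1) →
      ℓ 𝒜 ^ H ≤ 2 ^ H * C (n ∸ 1) (r ∸ 1) ^ h →
      ℓ 𝒜 ^ suc q ≤ (e 𝒜 + 2 * ℓ 𝒜) ^ q
    large-n-bound {n} {r} 𝒜 q<n n≤Er gap = go n r 𝒜 2c≤j n≤2Jj Wj≤r n≤Er gap
      where
      open ≤-Reasoning
      j = n / J
      n<J+jJ : n < J + j * J
      n<J+jJ = subst (_< J + j * J) (sym (m≡m%n+[m/n]*n n J)) (+-monoˡ-< (j * J) (m%n<n n J))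
      2cJ≤q : 2 * c * J ≤ q
      2cJ≤q = begin
        2 * c * J             ≤⟨ ≤-by _ _ 0 (z≤n {2 * c * J}) (id₁ c J) ⟩
        1 * (4 * J * c)       ≤⟨ *-monoˡ-≤ (4 * J * c) 1≤E ⟩
        E * (4 * J * c)       ∎
        where
        id₁ : ∀ c J → 2 * c * J + 2 * c * J + 0 ≡ 1 * (4 * J * c) + 0
        id₁ = solve-∀
      -- Otherwise (j + 1) J ≤ 2 c J ≤ q < n, although j is the quotient of n by J.
      2c≤j : 2 * c ≤ j
      2c≤j with 2 * c ≤? j
      ... | yes p = p
      ... | no ¬p = contradiction (≤-trans (*-monoˡ-≤ J (≰⇒> ¬p)) 2cJ≤q) (<⇒≱ (<-trans q<n n<J+jJ))
      1≤j : 1 ≤ j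
      1≤j = ≤-trans (*-mono-≤ {1} {2} (s≤s z≤n) 1≤c) 2c≤j
      n≤2Jj : n ≤ 2 * J * j
      n≤2Jj = ≤-trans (<⇒≤ n<J+jJ) (≤-by _ _ 0 (*-monoˡ-≤ J 1≤j) (id₁ j J))
        where
        id₁ : ∀ j J → J + j * J + j * J + 0 ≡ 2 * J * j + 1 * J
        id₁ = solve-∀
      Wj≤r : W * j ≤ r
      Wj≤r = *-cancelˡ-≤ E (begin
        E * (W * j)   ≡⟨ id₁ E W j ⟩
        j * (E * W)   ≤⟨ m/n*n≤m n J ⟩
        n             ≤⟨ n≤Er ⟩
        E * r         ∎)
        where
        id₁ : ∀ E W j → E * (W * j) ≡ j * (E * W)
        id₁ = solve-∀

      -- `n` is rebound while `j` keeps its outer value, so n can be split into constructors without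
      -- disturbing the quotient `n / J`.
      go : ∀ n r (𝒜 : Family n) → 2 * c ≤ j → n ≤ 2 * J * j → W * j ≤ r →
        n ≤ E * r → 2 * E * r + 2 * n ≤ n * E →
        Unique 𝒜 → Uniform r 𝒜 → length 𝒜 ≡ C (n ∸ 1) (r ∸ 1) →
        ℓ 𝒜 ^ H ≤ 2 ^ H * C (n ∸ 1) (r ∸ 1) ^ h →
        ℓ 𝒜 ^ suc q ≤ (e 𝒜 + 2 * ℓ 𝒜) ^ q
      go n r 𝒜 2c≤j n≤2Jj Wj≤r n≤Er gap
        -- W ≥ 2 and j ≥ 1 give r ≥ 2, and `gap` divided by E gives 2 r ≤ n.
        with ≤-trans (*-mono-≤ (m≤n+m 2 (H + 2 * E * H)) 1≤j) Wj≤r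
           | *-cancelˡ-≤ E (≤-by (E * (2 * r)) (E * n) (2 * n) gap (id₁ E r n))
        where
        id₁ : ∀ E r n → E * (2 * r) + n * E + 2 * n ≡ E * n + (2 * E * r + 2 * n)
        id₁ = solve-∀
      go (suc m) (suc (suc p)) 𝒜 2c≤j n≤2Jj Wj≤r n≤Er gap | s≤s (s≤s z≤n) | 2r≤n
        with m ∸ suc (suc p) | m∸n+n≡m {m} {suc (suc p)} (≤-pred (≤-by (suc (suc (suc p))) (suc m) (suc p) 2r≤n (id₁ p m)))
        where
        id₁ : ∀ p m → suc (suc (suc p)) + suc m + suc p ≡ suc m + 2 * suc (suc p)
        id₁ = solve-∀
      ... | k | refl =
        Large.bound 2c≤j n≤2Jj Wj≤r (≤-by (suc p) k 0 2r≤n (id₁ k p)) n≤Er (≤-by _ _ 0 gap (id₂ k p E)) 𝒜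
        where
        id₁ : ∀ k p → suc p + suc (k + suc (suc p)) + 0 ≡ k + 2 * suc (suc p)
        id₁ = solve-∀
        id₂ : ∀ k p E → 2 * suc (k + suc (suc p)) + E * suc p + suc (k + suc (suc p)) * E + 0
              ≡ E * k + (2 * E * suc (suc p) + 2 * suc (k + suc (suc p)))
        id₂ = solve-∀

    bound : ∀ {n r} (𝒜 : Family n) → n ≤ E * r → 2 * E * r + 2 * n ≤ n * E →
      Unique 𝒜 → Uniform r 𝒜 → length 𝒜 ≡ (n ∸ 1) choose (r ∸ 1) →
      ℓ 𝒜 ^ H ≤ 2 ^ H * ((n ∸ 1) choose (r ∸ 1)) ^ h →
      ℓ 𝒜 ^ suc q ≤ (e 𝒜 + 2 * ℓ 𝒜) ^ q
    bound {n} {r} 𝒜 n≤Er gap uniq unif size small rewrite sym (C≡choose (n ∸ 1) (r ∸ 1)) with q <? n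
    ... | yes q<n = large-n-bound 𝒜 q<n n≤Er gap uniq unif size small
    ... | no  q≮n = small-ℓ-bound (e 𝒜) (begin
      ℓ 𝒜                       ≤⟨ m≤n+m (ℓ 𝒜) (length (𝒜 ⋆)) ⟩
      length (𝒜 ⋆) + ℓ 𝒜        ≡⟨ length-⋆ 𝒜 ⟩
      length 𝒜                  ≡⟨ size ⟩
      C (n ∸ 1) (r ∸ 1)         ≤⟨ C≤2^ (n ∸ 1) (r ∸ 1) ⟩
      2 ^ (n ∸ 1)               ≤⟨ ^-monoʳ-≤ 2 (≤-trans (m∸n≤m n 1) (≮⇒≥ q≮n)) ⟩
      2 ^ q                     ∎)
      where open ≤-Reasoning


-- Rational numbers and cuts

open import Algebra.Bundles using (module CommutativeRing)
open import Data.Integer using (+_; -[1+_])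
import Data.Integer as ℤ
import Data.Integer.Properties as ℤ
open import Data.Nat using (zero; suc)
import Data.Nat as ℕ
import Data.Nat.Properties as ℕ
open import Data.Nat.Coprimality using (Coprime; coprime-+; 1-coprimeTo)
import Data.Nat.Coprimality as Coprimality
open import Data.Product using (∃-syntax; _,_)
open import Data.Rational hiding (NonZero; ∣_∣)
open import Data.Rational.Properties
open import Algebra.Properties.CommutativeSemiring.Exp (CommutativeRing.commutativeSemiring +-*-commutativeRing) using (^-distrib-*)
open import Data.Rational.Solver using (module +-*-Solver)
import Data.Rational.Unnormalised as ℚᵘ
import Data.Rational.Unnormalised.Properties as ℚᵘ
open import Data.Sum using (_⊎_; inj₁; inj₂)
open import Function.Bundles using (mk⇔)
open import Relation.Binary.Definitions using (tri<; tri≈; tri>)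
open import Relation.Binary.PropositionalEquality using (refl; sym; trans; cong; cong₂; subst; subst₂; module ≡-Reasoning)
open import Relation.Nullary using (¬_; yes; no; contradiction)
open +-*-Solver using (solve; _:+_; _:*_; :-_; _:=_; con)

open Combinatorics using (module Constants; bound)

ι : ℕ → ℚ
ι n = + n / 1

toℚᵘ-ι : ∀ n → toℚᵘ (ι n) ℚᵘ.≃ ℚᵘ.mkℚᵘ (+ n) 0
toℚᵘ-ι n = toℚᵘ-fromℚᵘ (ℚᵘ.mkℚᵘ (+ n) 0)

ι-< : ∀ {m n} → m ℕ.< n → ι m < ι n
ι-< {m} {n} m<n = toℚᵘ-cancel-< (ℚᵘ.<-respˡ-≃ (ℚᵘ.≃-sym (toℚᵘ-ι m)) (ℚᵘ.<-respʳ-≃ (ℚᵘ.≃-sym (toℚᵘ-ι n))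
  (ℚᵘ.*<* (subst₂ ℤ._<_ (sym (ℤ.*-identityʳ (+ m))) (sym (ℤ.*-identityʳ (+ n))) (ℤ.+<+ m<n)))))

ι-≤ : ∀ {m n} → m ℕ.≤ n → ι m ≤ ι n
ι-≤ m≤n with ℕ.m≤n⇒m<n∨m≡n m≤n
... | inj₁ m<n  = <⇒≤ (ι-< m<n)
... | inj₂ refl = ≤-refl

ι-cancel-< : ∀ {m n} → ι m < ι n → m ℕ.< n
ι-cancel-< {m} {n} h with m ℕ.<? n
... | yes p = p
... | no ¬p = contradiction (<-≤-trans h (ι-≤ (ℕ.≮⇒≥ ¬p))) (<-irrefl refl)

ι-* : ∀ m n → ι (m ℕ.* n) ≡ ι m * ι n
ι-* m n = toℚᵘ-injective (begin
  toℚᵘ (ι (m ℕ.* n))                        ≈⟨ toℚᵘ-ι (m ℕ.* n) ⟩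
  ℚᵘ.mkℚᵘ (+ (m ℕ.* n)) 0                   ≈⟨ ℚᵘ.*≡* (cong (ℤ._* + 1) (ℤ.pos-* m n)) ⟩
  ℚᵘ.mkℚᵘ (+ m) 0 ℚᵘ.* ℚᵘ.mkℚᵘ (+ n) 0      ≈⟨ ℚᵘ.*-cong (toℚᵘ-ι m) (toℚᵘ-ι n) ⟨
  toℚᵘ (ι m) ℚᵘ.* toℚᵘ (ι n)                ≈⟨ toℚᵘ-homo-* (ι m) (ι n) ⟨
  toℚᵘ (ι m * ι n)                          ∎)
  where open ℚᵘ.≃-Reasoning

ι-+ : ∀ m n → ι (m ℕ.+ n) ≡ ι m + ι n
ι-+ m n = toℚᵘ-injective (begin
  toℚᵘ (ι (m ℕ.+ n))                        ≈⟨ toℚᵘ-ι (m ℕ.+ n) ⟩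
  ℚᵘ.mkℚᵘ (+ (m ℕ.+ n)) 0                   ≈⟨ ℚᵘ.*≡* (cong (ℤ._* + 1) (cong₂ ℤ._+_ (sym (ℤ.*-identityʳ (+ m))) (sym (ℤ.*-identityʳ (+ n))))) ⟩
  ℚᵘ.mkℚᵘ (+ m) 0 ℚᵘ.+ ℚᵘ.mkℚᵘ (+ n) 0      ≈⟨ ℚᵘ.+-cong (toℚᵘ-ι m) (toℚᵘ-ι n) ⟨
  toℚᵘ (ι m) ℚᵘ.+ toℚᵘ (ι n)                ≈⟨ toℚᵘ-homo-+ (ι m) (ι n) ⟨
  toℚᵘ (ι m + ι n)                          ∎)
  where open ℚᵘ.≃-Reasoning

fraction : ∀ p {a d} → toℚᵘ p ℚᵘ.≃ ℚᵘ.mkℚᵘ (+ a) d → p * ι (suc d) ≡ ι a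
fraction p {a} {d} p≃ = toℚᵘ-injective (begin
  toℚᵘ (p * ι (suc d))                               ≈⟨ toℚᵘ-homo-* p (ι (suc d)) ⟩
  toℚᵘ p ℚᵘ.* toℚᵘ (ι (suc d))                       ≈⟨ ℚᵘ.*-cong p≃ (toℚᵘ-ι (suc d)) ⟩
  ℚᵘ.mkℚᵘ (+ a) d ℚᵘ.* ℚᵘ.mkℚᵘ (+ suc d) 0           ≈⟨ ℚᵘ.*≡* (trans (ℤ.*-identityʳ _) (cong (+ a ℤ.*_) (cong (λ e → + suc e) (sym (ℕ.*-identityʳ d))))) ⟩
  ℚᵘ.mkℚᵘ (+ a) 0                                    ≈⟨ toℚᵘ-ι a ⟨
  toℚᵘ (ι a)                                         ∎)
  where open ℚᵘ.≃-Reasoning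

recip : ℕ → ℚ
recip d = + 1 / suc d

recip-* : ∀ d → recip d * ι (suc d) ≡ 1ℚ
recip-* d = fraction (recip d) (toℚᵘ-fromℚᵘ (ℚᵘ.mkℚᵘ (+ 1) d))

recip>0 : ∀ d → 0ℚ < recip d
recip>0 d = positive⁻¹ (recip d) {{normalize-pos 1 (suc d)}}

archimedean : ∀ q → 0ℚ < q → ∃[ d ] recip d < q
archimedean (mkℚ (+ zero)   b c) (*<* (ℤ.+<+ ()))
archimedean (mkℚ -[1+ a ]   b c) (*<* ())
-- One more than the denominator, so that the inequality is strict even for numerator 1.
archimedean (mkℚ (+ suc a)  b c) _ = suc b , toℚᵘ-cancel-< (ℚᵘ.<-respˡ-≃ (ℚᵘ.≃-sym (toℚᵘ-fromℚᵘ (ℚᵘ.mkℚᵘ (+ 1) (suc b))))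
  (ℚᵘ.*<* (ℤ.+<+ (ℕ.s≤s (ℕ.≤-trans (ℕ.≤-reflexive (ℕ.+-identityʳ (suc b))) (ℕ.m≤m+n (suc b) (a ℕ.* suc (suc b))))))))

ι-pos : ∀ {n} → 0 ℕ.< n → Positive (ι n)
ι-pos {suc n} _ = normalize-pos (suc n) 1

fromℚ-isReal : ∀ p → IsReal (fromℚ p)
fromℚ-isReal p = record
  { lower-inhabited = p - 1ℚ , subst (p - 1ℚ <_) (+-identityʳ p) (+-monoʳ-< p (negative⁻¹ (- 1ℚ)))
  ; upper-inhabited = p + 1ℚ , subst (_< p + 1ℚ) (+-identityʳ p) (+-monoʳ-< p (positive⁻¹ 1ℚ))
  ; lower-rounded   = λ q → mk⇔ (λ q<p → <-dense q<p) (λ { (r , q<r , r<p) → <-trans q<r r<p })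
  ; upper-rounded   = λ q → mk⇔ (λ p<q → let r , p<r , r<q = <-dense p<q in r , r<q , p<r) (λ { (r , r<q , p<r) → <-trans p<r r<q })
  ; disjoint        = λ q (q<p , p<q) → <-irrefl refl (<-trans q<p p<q)
  ; located         = located
  }
  where
  located : ∀ a b → a < b → a < p ⊎ p < b
  located a b a<b with <-cmp a p
  ... | tri< a<p _ _ = inj₁ a<p
  ... | tri≈ _ refl _ = inj₂ a<b
  ... | tri> _ _ p<a = inj₂ (<-trans p<a a<b)

<-+⇒-< : ∀ {y} q z → y < q + z → y - q < z
<-+⇒-< {y} q z h = subst (y - q <_) (solve 2 (λ q z → (q :+ z) :+ (:- q) := z) refl q z) (+-monoˡ-< (- q) h)

+-<⇒<-- : ∀ {y} q z → q + z < y → z < y - q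
+-<⇒<-- {y} q z h = subst (_< y - q) (solve 2 (λ q z → (q :+ z) :+ (:- q) := z) refl q z) (+-monoˡ-< (- q) h)

+-sub : ∀ q y → y ≡ q + (y - q)
+-sub = solve 2 (λ q y → y := q :+ (y :+ (:- q))) refl

ι-suc-* : ∀ n q → ι (suc n) * q ≡ q + ι n * q
ι-suc-* n q = trans (cong (_* q) (ι-+ 1 n)) (solve 2 (λ x q → (con 1ℚ :+ x) :* q := q :+ x :* q) refl (ι n) q)

-- Each summand takes exactly q; the slack in y < n q is handed down to the final `fromℕ 0`, which
-- absorbs it.
·-lower : ∀ {x q} n {y} → lower x q → y < ι n * q → lower (n ·ᴿ x) y
·-lower {q = q} zero    xq h = subst (_ <_) (*-zeroˡ q) h
·-lower {q = q} (suc n) xq h = q , _ , xq , ·-lower n xq (<-+⇒-< q (ι n * q) (subst (_ <_) (ι-suc-* n q) h)) , +-sub q _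

·-upper : ∀ {x q} n {y} → upper x q → ι n * q < y → upper (n ·ᴿ x) y
·-upper {q = q} zero    xq h = subst (_< _) (*-zeroˡ q) h
·-upper {q = q} (suc n) xq h = q , _ , xq , ·-upper n xq (+-<⇒<-- q (ι n * q) (subst (_< _) (ι-suc-* n q) h)) , +-sub q _

·-upper⁻ : ∀ {p} n {y} → upper (n ·ᴿ fromℚ p) y → ι n * p < y
·-upper⁻ {p} zero    h = subst (_< _) (sym (*-zeroˡ p)) h
·-upper⁻ {p} (suc n) (a , b , p<a , h , refl) = subst (_< a + b) (sym (ι-suc-* n p)) (+-mono-< p<a (·-upper⁻ n h))

^-nonNeg : ∀ {a} n → 0ℚ ≤ a → 0ℚ ≤ a ^ℚ n
^-nonNeg zero    _   = <⇒≤ (positive⁻¹ 1ℚ)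
^-nonNeg {a} (suc n) 0≤a = subst (_≤ a * a ^ℚ n) (*-zeroʳ a) (*-monoˡ-≤-nonNeg a {{nonNegative 0≤a}} (^-nonNeg n 0≤a))

^-mono-≤ : ∀ {a b} n → 0ℚ ≤ a → a ≤ b → a ^ℚ n ≤ b ^ℚ n
^-mono-≤ zero    _   _   = ≤-refl
^-mono-≤ {a} {b} (suc n) 0≤a a≤b = ≤-trans (*-monoˡ-≤-nonNeg a {{nonNegative 0≤a}} (^-mono-≤ n 0≤a a≤b))
  (*-monoʳ-≤-nonNeg (b ^ℚ n) {{nonNegative (^-nonNeg n (≤-trans 0≤a a≤b))}} a≤b)

^-pos : ∀ {a} n → 0ℚ < a → 0ℚ < a ^ℚ n
^-pos zero    _ = positive⁻¹ 1ℚ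
^-pos {a} (suc n) 0<a = subst (_< a * a ^ℚ n) (*-zeroʳ a) (*-monoʳ-<-pos a {{positive 0<a}} (^-pos n 0<a))

ι-^ : ∀ m n → ι m ^ℚ n ≡ ι (m ℕ.^ n)
ι-^ m zero    = refl
ι-^ m (suc n) = trans (cong (ι m *_) (ι-^ m n)) (sym (ι-* m (m ℕ.^ n)))

-- The real hypotheses as inequalities between naturals.

r-lower-bound : ∀ {ε q d n r} → lower ε q → recip d < q → n ·ᴿ ε ≤ᴿ fromℕ r → n ℕ.≤ suc d ℕ.* r
r-lower-bound {ε} {q} {d} {n} {r} εq d<q h = ℕ.≮⇒≥ λ Er<n → let y , r<y , y<nq = <-dense (below Er<n) in h (y , r<y , ·-lower n εq y<nq)
  where
  below : suc d ℕ.* r ℕ.< n → ι r < ι n * q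
  below Er<n = begin-strict
    ι r                             ≡⟨ *-identityˡ (ι r) ⟨
    1ℚ * ι r                        ≡⟨ cong (_* ι r) (recip-* d) ⟨
    recip d * ι (suc d) * ι r       ≡⟨ *-assoc (recip d) _ _ ⟩
    recip d * (ι (suc d) * ι r)     ≡⟨ cong (recip d *_) (ι-* (suc d) r) ⟨
    recip d * ι (suc d ℕ.* r)       <⟨ *-monoʳ-<-pos (recip d) {{positive (recip>0 d)}} (ι-< Er<n) ⟩
    recip d * ι n                   ≡⟨ *-comm (recip d) (ι n) ⟩
    ι n * recip d                   ≤⟨ *-monoˡ-≤-nonNeg (ι n) {{nonNegative (ι-≤ {0} {n} ℕ.z≤n)}} (<⇒≤ d<q) ⟩
    ι n * q                         ∎
    where open ≤-Reasoning

-- With E = d + 1 and 1/E < ε this is r ≤ n (1/2 - 1/E), multiplied by 2 E. As `≤ᴿ` is a negation,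
-- the failure of the conclusion is turned into a rational between n (1/2 - 1/E) and r.
r-upper-bound : ∀ {ε q d n r} → lower ε q → recip d < q → fromℕ r ≤ᴿ n ·ᴿ (fromℚ ½ -ᴿ ε) →
                2 ℕ.* suc d ℕ.* r ℕ.+ 2 ℕ.* n ℕ.≤ n ℕ.* suc d
r-upper-bound {ε} {q} {d} {n} {r} εq d<q h = ℕ.≮⇒≥ λ lt → let y , nc<y , y<r = <-dense (above lt) in h (y , ·-upper n upper-c nc<y , y<r)
  where
  E = ι (suc d)
  c = ½ - recip d
  upper-c : upper (fromℚ ½ -ᴿ ε) c
  upper-c = ½ + (q - recip d) , - q
    , subst (_< ½ + (q - recip d)) (+-identityʳ ½) (+-monoʳ-< ½ (subst (_< q - recip d) (+-inverseʳ (recip d)) (+-monoˡ-< (- recip d) d<q)))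
    , subst (lower ε) (solve 1 (λ q → q := :- (:- q)) refl q) εq
    , solve 3 (λ h q e → h :+ (:- e) := (h :+ (q :+ (:- e))) :+ (:- q)) refl ½ q (recip d)
  above : n ℕ.* suc d ℕ.< 2 ℕ.* suc d ℕ.* r ℕ.+ 2 ℕ.* n → ι n * c < ι r
  above lt = *-cancelʳ-<-nonNeg (ι 2 * E) {{nonNegative (subst (0ℚ ≤_) (ι-* 2 (suc d)) (ι-≤ {0} {2 ℕ.* suc d} ℕ.z≤n))}}
    (+-cancelʳ-< (ι 2 * ι n) (begin-strict
    ι n * c * (ι 2 * E) + ι 2 * ι n                    ≡⟨ cong (λ x → ι n * c * (ι 2 * E) + x) (trans (sym (*-identityʳ _)) (cong (ι 2 * ι n *_) (sym (recip-* d)))) ⟩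
    ι n * c * (ι 2 * E) + ι 2 * ι n * (recip d * E)    ≡⟨
      solve 3 (λ n e E → n :* (con ½ :+ (:- e)) :* (con (ι 2) :* E) :+ con (ι 2) :* n :* (e :* E) := n :* E) refl (ι n) (recip d) E ⟩
    ι n * E                                            ≡⟨ ι-* n (suc d) ⟨
    ι (n ℕ.* suc d)                                    <⟨ ι-< lt ⟩
    ι (2 ℕ.* suc d ℕ.* r ℕ.+ 2 ℕ.* n)                  ≡⟨ ι-+ (2 ℕ.* suc d ℕ.* r) _ ⟩
    ι (2 ℕ.* suc d ℕ.* r) + ι (2 ℕ.* n)                ≡⟨ cong₂ _+_ (trans (ι-* (2 ℕ.* suc d) r) (trans (cong (_* ι r) (ι-* 2 (suc d))) (*-comm _ (ι r)))) (ι-* 2 n) ⟩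
    ι r * (ι 2 * E) + ι 2 * ι n                        ∎))
    where
    open ≤-Reasoning
    +-cancelʳ-< : ∀ z {x y} → x + z < y + z → x < y
    +-cancelʳ-< z {x} {y} h = subst₂ _<_ (cancel x) (cancel y) (+-monoˡ-< (- z) h)
      where
      cancel : ∀ x → x + z - z ≡ x
      cancel x = solve 2 (λ x z → (x :+ z) :+ (:- z) := x) refl x z

-- The factor 2 leaves room for the rational witness l / 2 of N^(1-η) < l, so that no root has to be approximated.
ℓ-bound : ∀ {η q h l N} → lower η q → recip h < q → fromℕ l ≤ᴿ N ^ᴿ (fromℕ 1 -ᴿ η) →
          l ℕ.^ suc h ℕ.≤ 2 ℕ.^ suc h ℕ.* N ℕ.^ h
ℓ-bound {l = zero} {N} ηq h<q hyp = ℕ.z≤n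
ℓ-bound {l = l@(suc _)} {zero} ηq h<q hyp = let y , 0<y , y<l = <-dense (ι-< {0} {l} ℕ.z<s) in contradiction (y , 0<y , y<l) hyp
ℓ-bound {η} {q} {h} {l@(suc _)} {suc k} ηq h<q hyp = ℕ.≮⇒≥ λ lt → hyp (ι l * ½ , (s , upper-s , 0<half , root lt) , half<)
  where
  H = suc h
  s : ℚ
  -- 1 - 1/H = h / (h + 1), built in lowest terms so that `qpow` at s computes to an H-th root of an
  -- h-th power.
  s = mkℚ (+ h) h (Coprimality.sym (subst (λ x → Coprime x h) (ℕ.+-comm h 1) (coprime-+ (1-coprimeTo h))))
  s≡ : s ≡ 1ℚ - recip h
  s≡ = begin
    s                                  ≡⟨ *-identityʳ s ⟨
    s * 1ℚ                             ≡⟨ cong (s *_) (trans (*-comm (ι H) _) (recip-* h)) ⟨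
    s * (ι H * recip h)                ≡⟨ *-assoc s (ι H) (recip h) ⟨
    s * ι H * recip h                  ≡⟨ cong (_* recip h) (fraction s ℚᵘ.≃-refl) ⟩
    ι h * recip h                      ≡⟨ solve 2 (λ x e → x :* e := e :* (con 1ℚ :+ x) :+ (:- e)) refl (ι h) (recip h) ⟩
    recip h * (1ℚ + ι h) - recip h     ≡⟨ cong (λ e → recip h * e - recip h) (ι-+ 1 h) ⟨
    recip h * ι H - recip h            ≡⟨ cong (_- recip h) (recip-* h) ⟩
    1ℚ - recip h                       ∎
    where open ≡-Reasoning
  upper-s : upper (fromℕ 1 -ᴿ η) s
  upper-s = 1ℚ + (q - recip h) , - q
    , subst (_< 1ℚ + (q - recip h)) (+-identityʳ 1ℚ) (+-monoʳ-< 1ℚ (subst (_< q - recip h) (+-inverseʳ (recip h)) (+-monoˡ-< (- recip h) h<q)))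
    , subst (lower η) (solve 1 (λ q → q := :- (:- q)) refl q) ηq
    , trans s≡ (solve 3 (λ h q e → h :+ (:- e) := (h :+ (q :+ (:- e))) :+ (:- q)) refl 1ℚ q (recip h))
  0<l : 0ℚ < ι l
  0<l = ι-< {0} {l} ℕ.z<s
  0<half : 0ℚ < ι l * ½
  0<half = subst (_< ι l * ½) (*-zeroʳ (ι l)) (*-monoʳ-<-pos (ι l) {{positive 0<l}} (positive⁻¹ ½))
  half< : ι l * ½ < ι l
  half< = subst (ι l * ½ <_) (*-identityʳ (ι l)) (*-monoʳ-<-pos (ι l) {{positive 0<l}} (*<* (ℤ.+<+ (ℕ.s≤s (ℕ.s≤s ℕ.z≤n)))))
  root : 2 ℕ.^ H ℕ.* suc k ℕ.^ h ℕ.< l ℕ.^ H → ι (suc k) ^ℚ h < (ι l * ½) ^ℚ H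
  root lt = begin-strict
    ι (suc k) ^ℚ h                            ≡⟨ *-identityˡ _ ⟨
    1ℚ * ι (suc k) ^ℚ h                       ≡⟨ cong (_* ι (suc k) ^ℚ h) (1^ H) ⟨
    (½ * ι 2) ^ℚ H * ι (suc k) ^ℚ h           ≡⟨ cong (_* ι (suc k) ^ℚ h) (^-distrib-* ½ (ι 2) H) ⟩
    ½ ^ℚ H * ι 2 ^ℚ H * ι (suc k) ^ℚ h        ≡⟨ cong₂ (λ x y → ½ ^ℚ H * x * y) (ι-^ 2 H) (ι-^ (suc k) h) ⟩
    ½ ^ℚ H * ι (2 ℕ.^ H) * ι (suc k ℕ.^ h)    ≡⟨ *-assoc (½ ^ℚ H) (ι (2 ℕ.^ H)) _ ⟩
    ½ ^ℚ H * (ι (2 ℕ.^ H) * ι (suc k ℕ.^ h))  ≡⟨ cong (½ ^ℚ H *_) (ι-* (2 ℕ.^ H) (suc k ℕ.^ h)) ⟨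
    ½ ^ℚ H * ι (2 ℕ.^ H ℕ.* suc k ℕ.^ h)      <⟨ *-monoʳ-<-pos (½ ^ℚ H) {{positive (^-pos H (positive⁻¹ ½))}} (ι-< lt) ⟩
    ½ ^ℚ H * ι (l ℕ.^ H)                      ≡⟨ cong (½ ^ℚ H *_) (ι-^ l H) ⟨
    ½ ^ℚ H * ι l ^ℚ H                         ≡⟨ *-comm (½ ^ℚ H) _ ⟩
    ι l ^ℚ H * ½ ^ℚ H                         ≡⟨ ^-distrib-* (ι l) ½ H ⟨
    (ι l * ½) ^ℚ H                            ∎
    where
    open ≤-Reasoning
    1^ : ∀ n → 1ℚ ^ℚ n ≡ 1ℚ
    1^ zero    = refl
    1^ (suc n) = trans (*-identityˡ _) (1^ n)

-- From naturals back to the real conclusion.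

exponent-bound : ∀ {q s d m} → s < 1ℚ + recip q → s * ι (suc d) ≡ ι m → m ℕ.* suc q ℕ.< suc (suc q) ℕ.* suc d
exponent-bound {q} {s} {d} {m} s<1+δ s*d≡m = ι-cancel-< (begin-strict
  ι (m ℕ.* suc q)                            ≡⟨ ι-* m (suc q) ⟩
  ι m * ι (suc q)                            ≡⟨ cong (_* ι (suc q)) s*d≡m ⟨
  s * ι (suc d) * ι (suc q)                  ≡⟨ *-assoc s _ _ ⟩
  s * (ι (suc d) * ι (suc q))                <⟨ *-monoˡ-<-pos (ι (suc d) * ι (suc q)) {{subst Positive (ι-* (suc d) (suc q)) (ι-pos {suc d ℕ.* suc q} ℕ.z<s)}} s<1+δ ⟩
  (1ℚ + recip q) * (ι (suc d) * ι (suc q))   ≡⟨ solve 3 (λ e d q → (con 1ℚ :+ e) :* (d :* q) := (e :* q :+ q) :* d) refl (recip q) (ι (suc d)) (ι (suc q)) ⟩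
  (recip q * ι (suc q) + ι (suc q)) * ι (suc d)  ≡⟨ cong (λ e → (e + ι (suc q)) * ι (suc d)) (recip-* q) ⟩
  (1ℚ + ι (suc q)) * ι (suc d)               ≡⟨ cong (_* ι (suc d)) (ι-+ 1 (suc q)) ⟨
  ι (suc (suc q)) * ι (suc d)                ≡⟨ ι-* (suc (suc q)) (suc d) ⟨
  ι (suc (suc q) ℕ.* suc d)                  ∎)
  where open ≤-Reasoning

-- A nonnegative a below the power comes with an exponent s = m / d < (q + 2) / (q + 1) such that
-- a^d < l^m. If T < a, then T^d < l^m, and raising this to the power q + 1 contradicts l^(q+2) ≤
-- T^(q+1).
power-lower-bound : ∀ {l T q a} → l ℕ.≤ T → l ℕ.^ suc (suc q) ℕ.≤ T ℕ.^ suc q →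
  lower (l ^ᴿ (fromℕ 1 +ᴿ fromℚ (recip q))) a → a ≤ ι T
power-lower-bound {zero}  {T} l≤T bnd a<0 = ≤-trans (<⇒≤ a<0) (ι-≤ {0} {T} ℕ.z≤n)
power-lower-bound {suc k} {T} l≤T bnd (s , _ , inj₁ a<0) = ≤-trans (<⇒≤ a<0) (ι-≤ {0} {T} ℕ.z≤n)
power-lower-bound {suc k} {T} {q} {a} l≤T bnd (s , (a′ , b′ , a′<1 , b′<δ , s≡) , inj₂ a^d<) =
  ≮⇒≥ λ T<a → contra s (subst (_< 1ℚ + recip q) (sym s≡) (+-mono-< a′<1 b′<δ))
    (≤-<-trans (subst (_≤ a ^ℚ ↧ₙ s) (ι-^ T (↧ₙ s)) (^-mono-≤ (↧ₙ s) (ι-≤ {0} {T} ℕ.z≤n) (<⇒≤ T<a))) a^d<)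
  where
  l = suc k
  contra : ∀ s → s < 1ℚ + recip q → ι (T ℕ.^ ↧ₙ s) < zpow k (↥ s) → _
  contra s@(mkℚ (+ m) d _) s<1+δ h = ℕ.<-irrefl refl (begin-strict
    l ℕ.^ (m ℕ.* suc q)                    ≤⟨ ℕ.^-monoʳ-≤ l (ℕ.<⇒≤ (exponent-bound {q} {s} {d} {m} s<1+δ (fraction s ℚᵘ.≃-refl))) ⟩
    l ℕ.^ (suc (suc q) ℕ.* suc d)          ≡⟨ ℕ.^-*-assoc l (suc (suc q)) (suc d) ⟨
    (l ℕ.^ suc (suc q)) ℕ.^ suc d          ≤⟨ ℕ.^-monoˡ-≤ (suc d) bnd ⟩
    (T ℕ.^ suc q) ℕ.^ suc d                ≡⟨ ℕ.^-*-assoc T (suc q) (suc d) ⟩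
    T ℕ.^ (suc q ℕ.* suc d)                ≡⟨ cong (T ℕ.^_) (ℕ.*-comm (suc q) (suc d)) ⟩
    T ℕ.^ (suc d ℕ.* suc q)                ≡⟨ ℕ.^-*-assoc T (suc d) (suc q) ⟨
    (T ℕ.^ suc d) ℕ.^ suc q                <⟨ ℕ.^-monoˡ-< (suc q) (ι-cancel-< {T ℕ.^ suc d} {l ℕ.^ m} (subst (ι (T ℕ.^ suc d) <_) (ι-^ l m) h)) ⟩
    (l ℕ.^ m) ℕ.^ suc q                    ≡⟨ ℕ.^-*-assoc l m (suc q) ⟩
    l ℕ.^ (m ℕ.* suc q)                    ∎)
    where open ℕ.≤-Reasoning
  -- A negative exponent makes the power at most 1, while T ≥ l ≥ 1.
  contra (mkℚ -[1+ m ] d _) _ h = <-irrefl refl (begin-strict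
    1ℚ                        ≤⟨ ι-≤ {1} {T ℕ.^ suc d} (ℕ.m^n>0 T {{ℕ.>-nonZero (ℕ.≤-trans (ℕ.s≤s ℕ.z≤n) l≤T)}} (suc d)) ⟩
    ι (T ℕ.^ suc d)           <⟨ h ⟩
    recip k ^ℚ suc m          ≤⟨ ^-mono-≤ (suc m) (<⇒≤ (recip>0 k)) recip≤1 ⟩
    1ℚ ^ℚ suc m               ≡⟨ ι-^ 1 (suc m) ⟩
    ι (1 ℕ.^ suc m)           ≡⟨ cong ι (ℕ.^-zeroˡ (suc m)) ⟩
    1ℚ                        ∎)
    where
    open ≤-Reasoning
    recip≤1 : recip k ≤ 1ℚ
    recip≤1 = subst₂ _≤_ (*-identityʳ (recip k)) (recip-* k) (*-monoˡ-≤-nonNeg (recip k) {{nonNegative (<⇒≤ (recip>0 k))}} (ι-≤ {1} {suc k} (ℕ.s≤s ℕ.z≤n)))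

-- A rational above e and below the difference splits as a + b with -b > 2 l, so a > e + 2 l, too
-- large for a lower bound of the power.
real-bound : ∀ {l e q} → l ℕ.^ suc (suc q) ℕ.≤ (e ℕ.+ 2 ℕ.* l) ℕ.^ suc q →
  l ^ᴿ (fromℕ 1 +ᴿ fromℚ (recip q)) -ᴿ l ·ᴿ fromℕ 2 ≤ᴿ fromℕ e
real-bound {l} {e} {q} bnd (_ , e<x , a , b , la , lb , refl) = <-irrefl refl (begin-strict
  ι (e ℕ.+ 2 ℕ.* l)    ≡⟨ trans (ι-+ e (2 ℕ.* l)) (cong (_+_ (ι e)) (trans (ι-* 2 l) (*-comm (ι 2) (ι l)))) ⟩
  ι e + ι l * ι 2      <⟨ +-mono-< e<x (·-upper⁻ l lb) ⟩
  a + b + - b          ≡⟨ solve 2 (λ a b → (a :+ b) :+ (:- b) := a) refl a b ⟩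
  a                    ≤⟨ power-lower-bound {l} {e ℕ.+ 2 ℕ.* l} {q} (ℕ.≤-trans (ℕ.m≤m+n l (l ℕ.+ 0)) (ℕ.m≤n+m (2 ℕ.* l) e)) bnd la ⟩
  ι (e ℕ.+ 2 ℕ.* l)    ∎)
  where open ≤-Reasoning

lemma3p4 : ∀ (ε : Cut) → IsReal ε → fromℕ 0 <ᴿ ε →
    Σ[ C ∈ Cut ] (IsReal C × fromℕ 0 <ᴿ C ×
    (∀ (η : Cut) → IsReal η → fromℕ 0 <ᴿ η →
    Σ[ δ ∈ Cut ] (IsReal δ × fromℕ 0 <ᴿ δ ×
    (∀ (n r : ℕ) .{{_ : NonZero n}} →
    n ·ᴿ ε ≤ᴿ fromℕ r →
    fromℕ r ≤ᴿ n ·ᴿ (fromℚ ½ -ᴿ ε) →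
    ∀ (𝒜 : Family n) → Unique 𝒜 → All (λ A → ∣ A ∣ ≡ r) 𝒜 →
    length 𝒜 ≡ (n ∸ 1) choose (r ∸ 1) →
    fromℕ (ℓ 𝒜) ≤ᴿ ((n ∸ 1) choose (r ∸ 1)) ^ᴿ (fromℕ 1 -ᴿ η) →
    ℓ 𝒜 ^ᴿ (fromℕ 1 +ᴿ δ) -ᴿ ℓ 𝒜 ·ᴿ C ≤ᴿ fromℕ (e 𝒜)))))
lemma3p4 ε _ (p , 0<p , εp) =
  fromℕ 2 , fromℚ-isReal (ι 2) , <-dense (ι-< {0} {2} ℕ.z<s) , λ η _ (p′ , 0<p′ , ηp′) →
  let d , d<p  = archimedean p 0<p
      h , h<p′ = archimedean p′ 0<p′
      q  = Constants.q (suc d) h (ℕ.s≤s ℕ.z≤n)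
      -- `recip` adds one to its argument, so δ = `recip q₀` is 1 / q.
      q₀ = ℕ.pred q
      sq = ℕ.suc-pred q {{ℕ.>-nonZero (Constants.1≤q (suc d) h (ℕ.s≤s ℕ.z≤n))}}
  in fromℚ (recip q₀) , fromℚ-isReal _ , <-dense (recip>0 q₀) ,
     λ n r n·ε≤r r≤ 𝒜 uniq unif size small →
     real-bound {ℓ 𝒜} {e 𝒜} {q₀} (subst (λ q → ℓ 𝒜 ℕ.^ suc q ℕ.≤ (e 𝒜 ℕ.+ 2 ℕ.* ℓ 𝒜) ℕ.^ q) (sym sq)
       (bound (suc d) h (ℕ.s≤s ℕ.z≤n) {n} {r} 𝒜
         (r-lower-bound {ε} {p} {d} {n} {r} εp d<p n·ε≤r)
         (r-upper-bound {ε} {p} {d} {n} {r} εp d<p r≤)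
         uniq unif size
         (ℓ-bound {η} {p′} {h} {ℓ 𝒜} {(n ∸ 1) choose (r ∸ 1)} ηp′ h<p′ small)))
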